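{- Let $r$ be a line in $\mathbb{P}^2_{\mathbb{C}}$ and let $1,\dots,6$ be distinct points of $r$. Let $\mathcal{L}=\{\ell_{123},\ell_{156},\ell_{246},\ell_{345}\}$, where $\ell_{ijk}$ is the combinatorial line consisting of the points $i,j,k$. Let $\{R_1,R_2,R_3,U\}$ be a frame of reference of $\mathbb{P}^2_{\mathbb{C}}$. Then the following statements are equivalent: (i) The points $1,\dots,6$ are the projective image of a quadrilateral set. (ii) The polynomials $QS(\ell;P^1,P^2,P^3)$ vanish for any $\ell\in\mathcal{L}$ and any $P^1,P^2,P^3\in\mathbb{P}^2_{\mathbb{C}}$. (iii) The polynomials $QS(\ell;R_i,R_j,R_k)$ vanish for any $\ell\in\mathcal{L}$ and any $(i,j,k)\in\{1,2,3\}^3$. (iv) The polynomials $QS(\ell_{123};R_i,R_j,R_k)$ vanish for any $(i,j,k)\in\{1,2,3\}^3$. (v) The polynomials $QS(\ell_{123};R_i,R_j,R_k)$ vanish for any $(i,j,k)\in\{1,2,3\}^3$ with $i\le j\le k$.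
   Context: A quadrilateral set in $\mathbb{P}^2_{\mathbb{C}}$ consists of four lines and their six (pairwise distinct) intersection points. Its points are labelled $1,\dots,6$ so that the four lines contain the triples $\{1,2,3\},\{1,5,6\},\{2,4,6\},\{3,4,5\}$. The points $1,\dots,6$ of $r$ are the projective image of a quadrilateral set if there are a point $P\notin r$ and a quadrilateral set with points $p_1,\dots,p_6$ labelled in this way such that the projection from $P$ onto $r$ maps $p_i$ to the point $i$ for every $i$. Brackets: $[a\,b\,c]$ is the determinant of the $3\times3$ matrix whose columns are chosen homogeneous coordinate vectors of $a,b,c$; the vanishing of the polynomials below does not depend on the chosen representatives. $R_1,R_2,R_3$ are represented by linearly independent vectors whose sum represents $U$. For $\ell\in\mathcal{L}$ with points $P_\ell^1,P_\ell^2,P_\ell^3$ (in a fixed order), let $P_m^1,P_m^2,P_m^3$ be the three points not on $\ell$, labelled so that $\{P_\ell^1,P_m^1,P_m^2\}$, $\{P_\ell^2,P_m^2,P_m^3\}$, $\{P_\ell^3,P_m^1,P_m^3\}$ are the other three combinatorial lines. Then $$QS(\ell;P^1,P^2,P^3)=[P_\ell^1P_m^1P^1][P_\ell^2P_m^2P^2][P_\ell^3P_m^3P^3]-[P_\ell^1P_m^2P^1][P_\ell^2P_m^3P^2][P_\ell^3P_m^1P^3].$$ In particular $QS(\ell_{123};P^1,P^2,P^3)=[1\,5\,P^1][2\,6\,P^2][3\,4\,P^3]-[1\,6\,P^1][2\,4\,P^2][3\,5\,P^3]$. -}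

module Defs where

open import Level using (0ℓ; _⊔_)
open import Algebra.Apartness.Bundles using (HeytingCommutativeRing; HeytingField)
open import Algebra.Bundles using (CommutativeRing)
import Algebra.Properties.CommutativeMonoid.Sum as CommutativeMonoidSum
open import Data.Fin using (Fin; zero; suc)
import Data.Nat as ℕ
import Data.Nat.Properties as ℕ
open import Data.Nat using (ℕ)
open import Data.Product using (∃-syntax; _×_; _,_; proj₁; proj₂)
open import Data.Rational as ℚ using (ℚ; 0ℚ; 1ℚ; ½)
import Data.Rational
import Data.Rational.Properties as ℚ
open import Data.Rational.Solver using (module +-*-Solver)
open import Data.Sum using (_⊎_; inj₁; inj₂; [_,_]′)
open import Data.Vec using (Vec; lookup)
open import Data.Vec.Functional using (Vector)
open import Function using (_⇔_; _∘_)
open import Relation.Binary.PropositionalEquality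
  using (_≡_; _≢_; refl; sym; trans; cong; cong₂; subst; subst₂)
open import Relation.Nullary using (¬_; yes; no; contradiction)

open +-*-Solver using (solve; con; _:+_; _:*_; _:-_; :-_; _:=_)

module _ where
  open Data.Rational

  half-pos : ∀ {ε} → 0ℚ < ε → 0ℚ < ½ * ε
  half-pos {ε} 0<ε = subst (_< ½ * ε) (ℚ.*-zeroʳ ½) (ℚ.*-monoʳ-<-pos ½ 0<ε)

  half+half : ∀ ε → ½ * ε + ½ * ε ≡ ε
  half+half = solve 1 (λ ε → con ½ :* ε :+ con ½ :* ε := ε) refl

  divide : ∀ {B ε} → 0ℚ < B → 0ℚ < ε → ∃[ δ ] 0ℚ < δ × B * δ ≡ ε
  divide {B} {ε} 0<B 0<ε = 1/ B * ε , δ-pos , eq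
    where
    instance
      B-pos : Positive B
      B-pos = positive 0<B
      B-nz : NonZero B
      B-nz = ℚ.pos⇒nonZero B
      1/B-pos : Positive (1/ B)
      1/B-pos = ℚ.1/pos⇒pos B
    δ-pos : 0ℚ < 1/ B * ε
    δ-pos = subst (_< 1/ B * ε) (ℚ.*-zeroʳ (1/ B)) (ℚ.*-monoʳ-<-pos (1/ B) 0<ε)
    eq : B * (1/ B * ε) ≡ ε
    eq = trans (sym (ℚ.*-assoc B (1/ B) ε))
               (trans (cong (_* ε) (ℚ.*-inverseʳ B)) (ℚ.*-identityˡ ε))

  ∣∣-triangle⁻ : ∀ u v → ∣ u ∣ ≤ ∣ u + v ∣ + ∣ v ∣
  ∣∣-triangle⁻ u v = subst₂ (λ s t → ∣ s ∣ ≤ ∣ u + v ∣ + t)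
    (solve 2 (λ u v → (u :+ v) :+ (:- v) := u) refl u v)
    (ℚ.∣-p∣≡∣p∣ v)
    (ℚ.∣p+q∣≤∣p∣+∣q∣ (u + v) (- v))

  +-cancelʳ-≤ : ∀ {p q} r → p + r ≤ q + r → p ≤ q
  +-cancelʳ-≤ {p} {q} r le =
    subst₂ _≤_ (lem p) (lem q) (ℚ.+-monoˡ-≤ (- r) le)
    where
    lem : ∀ s → s + r + (- r) ≡ s
    lem s = solve 2 (λ s r → s :+ r :+ (:- r) := s) refl s r

-- Null families of rationals, along a directed index set with tails
-- { i | N ≼ i }; used for single sequences and for double sequences.

module Tails {I : Set} (_≼_ : ℕ → I → Set)
             (≼-mono : ∀ {M N i} → M ℕ.≤ N → N ≼ i → M ≼ i) where
  open Data.Rational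

  Eventually : (I → Set) → Set
  Eventually P = ∃[ N ] (∀ i → N ≼ i → P i)

  Null : (I → ℚ) → Set
  Null f = ∀ ε → 0ℚ < ε → Eventually λ i → ∣ f i ∣ < ε

  Bounded : (I → ℚ) → Set
  Bounded f = ∃[ B ] 0ℚ < B × Eventually λ i → ∣ f i ∣ ≤ B

  Away : (I → ℚ) → Set
  Away f = ∃[ ε ] 0ℚ < ε × Eventually λ i → ε ≤ ∣ f i ∣

  eventually₂ : ∀ {P Q R : I → Set} → (∀ i → P i → Q i → R i) →
                Eventually P → Eventually Q → Eventually R
  eventually₂ h (M , p) (N , q) = M ℕ.⊔ N , λ i MN≼i →
    h i (p i (≼-mono (ℕ.m≤m⊔n M N) MN≼i)) (q i (≼-mono (ℕ.m≤n⊔m M N) MN≼i))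

  null-cong : ∀ {f g} → Eventually (λ i → f i ≡ g i) → Null f → Null g
  null-cong f≡g nf ε 0<ε =
    eventually₂ (λ i → subst (λ t → ∣ t ∣ < ε)) f≡g (nf ε 0<ε)

  null-ext : ∀ {f g} → (∀ i → f i ≡ g i) → Null f → Null g
  null-ext f≡g = null-cong (0 , λ i _ → f≡g i)

  null-0 : Null λ _ → 0ℚ
  null-0 ε 0<ε = 0 , λ _ _ → 0<ε

  null-neg : ∀ {f} → Null f → Null λ i → - f i
  null-neg {f} nf ε 0<ε with nf ε 0<ε
  ... | N , h = N , λ i N≼i → subst (_< ε) (sym (ℚ.∣-p∣≡∣p∣ (f i))) (h i N≼i)

  null-+ : ∀ {f g} → Null f → Null g → Null λ i → f i + g i
  null-+ {f} {g} nf ng ε 0<ε = eventually₂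
    (λ i p q → ℚ.≤-<-trans (ℚ.∣p+q∣≤∣p∣+∣q∣ (f i) (g i))
      (subst (∣ f i ∣ + ∣ g i ∣ <_) (half+half ε) (ℚ.+-mono-< p q)))
    (nf _ (half-pos 0<ε)) (ng _ (half-pos 0<ε))

  null-* : ∀ {f g} → Bounded f → Null g → Null λ i → f i * g i
  null-* {f} {g} (B , 0<B , bf) ng ε 0<ε with divide 0<B 0<ε
  ... | δ , 0<δ , Bδ≡ε = eventually₂ step bf (ng δ 0<δ)
    where
    step : ∀ i → ∣ f i ∣ ≤ B → ∣ g i ∣ < δ → ∣ f i * g i ∣ < ε
    step i p q = subst₂ _<_ (sym (ℚ.∣p*q∣≡∣p∣*∣q∣ (f i) (g i))) Bδ≡ε
      (ℚ.≤-<-trans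
        (ℚ.*-monoʳ-≤-nonNeg ∣ g i ∣ {{ℚ.∣-∣-nonNeg (g i)}} p)
        (ℚ.*-monoʳ-<-pos B {{positive 0<B}} q))

  away-cong : ∀ {f g} → Eventually (λ i → f i ≡ g i) → Away f → Away g
  away-cong f≡g (ε , 0<ε , h) =
    ε , 0<ε , eventually₂ (λ i → subst (λ t → ε ≤ ∣ t ∣)) f≡g h

  away-ext : ∀ {f g} → (∀ i → f i ≡ g i) → Away f → Away g
  away-ext f≡g = away-cong (0 , λ i _ → f≡g i)

  away-neg : ∀ {f} → Away f → Away λ i → - f i
  away-neg {f} (ε , 0<ε , N , h) =
    ε , 0<ε , N , λ i N≼i → subst (ε ≤_) (sym (ℚ.∣-p∣≡∣p∣ (f i))) (h i N≼i)

  away-factor : ∀ {f g} → Bounded f → Away (λ i → f i * g i) → Away g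
  away-factor {f} {g} (B , 0<B , bf) (ε , 0<ε , h) with divide 0<B 0<ε
  ... | δ , 0<δ , Bδ≡ε = δ , 0<δ , eventually₂ step bf h
    where
    step : ∀ i → ∣ f i ∣ ≤ B → ε ≤ ∣ f i * g i ∣ → δ ≤ ∣ g i ∣
    step i p q = ℚ.*-cancelˡ-≤-pos B {{positive 0<B}}
      (subst (_≤ B * ∣ g i ∣) (sym Bδ≡ε)
        (ℚ.≤-trans (subst (ε ≤_) (ℚ.∣p*q∣≡∣p∣*∣q∣ (f i) (g i)) q)
                   (ℚ.*-monoʳ-≤-nonNeg ∣ g i ∣ {{ℚ.∣-∣-nonNeg (g i)}} p)))

  away+null : ∀ {f g} → Away f → Null g → Away λ i → f i + g i
  away+null {f} {g} (ε , 0<ε , h) ng =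
    ½ * ε , half-pos 0<ε , eventually₂ step h (ng _ (half-pos 0<ε))
    where
    step : ∀ i → ε ≤ ∣ f i ∣ → ∣ g i ∣ < ½ * ε → ½ * ε ≤ ∣ f i + g i ∣
    step i p q = +-cancelʳ-≤ (½ * ε)
      (subst (_≤ ∣ f i + g i ∣ + ½ * ε) (sym (half+half ε))
        (ℚ.≤-trans p (ℚ.≤-trans (∣∣-triangle⁻ (f i) (g i))
                                 (ℚ.+-monoʳ-≤ ∣ f i + g i ∣ (ℚ.<⇒≤ q)))))

open Tails {ℕ} ℕ._≤_ ℕ.≤-trans public

module Double = Tails {ℕ × ℕ} (λ N (m , n) → N ℕ.≤ m × N ℕ.≤ n)
  (λ M≤N (N≤m , N≤n) → ℕ.≤-trans M≤N N≤m , ℕ.≤-trans M≤N N≤n)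

-- Cauchy sequences of rationals, with equality up to null sequences.

record ℝ : Set where
  constructor mkℝ
  field
    seq    : ℕ → ℚ
    cauchy : Double.Null λ (m , n) → seq m ℚ.- seq n

open ℝ public

infix 4 _≈ℝ_ _#ℝ_

_≈ℝ_ : ℝ → ℝ → Set
x ≈ℝ y = Null λ n → seq x n ℚ.- seq y n

-- Apartness, the positive form of inequality: eventually |xₙ - yₙ| ≥ ε
-- for some ε > 0.
_#ℝ_ : ℝ → ℝ → Set
x #ℝ y = Away λ n → seq x n ℚ.- seq y n

bounded : ∀ x → Bounded (seq x)
bounded x with cauchy x 1ℚ (ℚ.positive⁻¹ 1ℚ)
... | N , h = B , 0<B , N , bound
  where
  open Data.Rational
  a B : ℚ
  a = ∣ seq x N ∣
  B = 1ℚ + a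
  0<B : 0ℚ < B
  0<B = ℚ.+-mono-<-≤ (ℚ.positive⁻¹ 1ℚ) (ℚ.0≤∣p∣ (seq x N))
  bound : ∀ n → N ℕ.≤ n → ∣ seq x n ∣ ≤ B
  bound n N≤n = ℚ.≤-trans
    (subst (λ t → ∣ t ∣ ≤ ∣ seq x n - seq x N ∣ + a)
      (solve 2 (λ p q → (p :- q) :+ q := p) refl (seq x n) (seq x N))
      (ℚ.∣p+q∣≤∣p∣+∣q∣ (seq x n - seq x N) (seq x N)))
    (ℚ.+-monoˡ-≤ a (ℚ.<⇒≤ (h (n , N) (N≤n , ℕ.≤-refl))))

boundedˡ : ∀ {f : ℕ → ℚ} → Bounded f → Double.Bounded λ (m , n) → f m
boundedˡ (B , 0<B , N , h) = B , 0<B , N , λ (m , n) (N≤m , _) → h m N≤m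

boundedʳ : ∀ {f : ℕ → ℚ} → Bounded f → Double.Bounded λ (m , n) → f n
boundedʳ (B , 0<B , N , h) = B , 0<B , N , λ (m , n) (_ , N≤n) → h n N≤n

constℝ : ℚ → ℝ
constℝ q = mkℝ (λ _ → q)
  (Double.null-ext (λ _ → sym (ℚ.+-inverseʳ q)) Double.null-0)

infixl 6 _+ℝ_
infixl 7 _*ℝ_
infix  8 -ℝ_

_+ℝ_ : ℝ → ℝ → ℝ
x +ℝ y = mkℝ (λ n → seq x n ℚ.+ seq y n)
  (Double.null-ext
    (λ (m , n) → solve 4 (λ a b c d → (a :- b) :+ (c :- d) := (a :+ c) :- (b :+ d)) refl
                   (seq x m) (seq x n) (seq y m) (seq y n))
    (Double.null-+ (cauchy x) (cauchy y)))

-ℝ_ : ℝ → ℝ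
-ℝ x = mkℝ (λ n → ℚ.- seq x n)
  (Double.null-ext
    (λ (m , n) → solve 2 (λ a b → :- (a :- b) := (:- a) :- (:- b)) refl (seq x m) (seq x n))
    (Double.null-neg (cauchy x)))

_*ℝ_ : ℝ → ℝ → ℝ
x *ℝ y = mkℝ (λ n → seq x n ℚ.* seq y n)
  (Double.null-ext
    (λ (m , n) → solve 4 (λ a b c d → a :* (c :- d) :+ d :* (a :- b) := a :* c :- b :* d) refl
                   (seq x m) (seq x n) (seq y m) (seq y n))
    (Double.null-+ (Double.null-* (boundedˡ (bounded x)) (cauchy y))
                   (Double.null-* (boundedʳ (bounded y)) (cauchy x))))

≈ℝ-pointwise : ∀ x y → Eventually (λ n → seq x n ≡ seq y n) → x ≈ℝ y
≈ℝ-pointwise x y (N , h) = null-cong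
  (N , λ n N≤n → sym (trans (cong (ℚ._- seq y n) (h n N≤n)) (ℚ.+-inverseʳ (seq y n))))
  null-0

≈ℝ-refl : ∀ x → x ≈ℝ x
≈ℝ-refl x = ≈ℝ-pointwise x x (0 , λ _ _ → refl)

≈ℝ-sym : ∀ x y → x ≈ℝ y → y ≈ℝ x
≈ℝ-sym x y x≈y = null-ext
  (λ n → solve 2 (λ a b → :- (a :- b) := b :- a) refl (seq x n) (seq y n)) (null-neg x≈y)

≈ℝ-trans : ∀ x y z → x ≈ℝ y → y ≈ℝ z → x ≈ℝ z
≈ℝ-trans x y z x≈y y≈z = null-ext
  (λ n → solve 3 (λ a b c → (a :- b) :+ (b :- c) := a :- c) refl (seq x n) (seq y n) (seq z n))
  (null-+ x≈y y≈z)

+ℝ-cong : ∀ x x′ y y′ → x ≈ℝ x′ → y ≈ℝ y′ → x +ℝ y ≈ℝ x′ +ℝ y′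
+ℝ-cong x x′ y y′ p q = null-ext
  (λ n → solve 4 (λ a b c d → (a :- b) :+ (c :- d) := (a :+ c) :- (b :+ d)) refl
           (seq x n) (seq x′ n) (seq y n) (seq y′ n))
  (null-+ p q)

-ℝ-cong : ∀ x y → x ≈ℝ y → -ℝ x ≈ℝ -ℝ y
-ℝ-cong x y p = null-ext
  (λ n → solve 2 (λ a b → :- (a :- b) := (:- a) :- (:- b)) refl (seq x n) (seq y n))
  (null-neg p)

*ℝ-cong : ∀ x x′ y y′ → x ≈ℝ x′ → y ≈ℝ y′ → x *ℝ y ≈ℝ x′ *ℝ y′
*ℝ-cong x x′ y y′ p q = null-ext
  (λ n → solve 4 (λ a b c d → a :* (c :- d) :+ d :* (a :- b) := a :* c :- b :* d) refl
           (seq x n) (seq x′ n) (seq y n) (seq y′ n))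
  (null-+ (null-* (bounded x) q) (null-* (bounded y′) p))

away⇒¬null : ∀ {f : ℕ → ℚ} → Away f → ¬ Null f
away⇒¬null (ε , 0<ε , N , h) nf with nf ε 0<ε
... | M , h′ = ℚ.<-irrefl refl
  (ℚ.≤-<-trans (h (N ℕ.⊔ M) (ℕ.m≤m⊔n N M)) (h′ (N ℕ.⊔ M) (ℕ.m≤n⊔m N M)))

away-or-small : ∀ x ε → ℚ.0ℚ ℚ.< ε →
                Away (seq x) ⊎ Eventually (λ n → ℚ.∣ seq x n ∣ ℚ.< ε)
away-or-small x ε 0<ε = go (cauchy x δ 0<δ)
  where
  open Data.Rational
  η δ : ℚ
  η = ½ * ε
  δ = ½ * η
  0<δ : 0ℚ < δ
  0<δ = half-pos (half-pos 0<ε)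
  δ≤η : δ ≤ η
  δ≤η = subst₂ _≤_ (ℚ.+-identityʳ δ) (half+half η) (ℚ.+-monoʳ-≤ δ (ℚ.<⇒≤ 0<δ))
  split : ∀ p q → ∣ p ∣ ≤ ∣ p - q ∣ + ∣ q ∣
  split p q = subst (λ t → ∣ t ∣ ≤ ∣ p - q ∣ + ∣ q ∣)
    (solve 2 (λ p q → (p :- q) :+ q := p) refl p q) (ℚ.∣p+q∣≤∣p∣+∣q∣ (p - q) q)
  go : Double.Eventually (λ (m , n) → ∣ seq x m - seq x n ∣ < δ) →
       Away (seq x) ⊎ Eventually (λ n → ∣ seq x n ∣ < ε)
  go (N , h) with ∣ seq x N ∣ <? η
  ... | yes small = inj₂ (N , λ n N≤n → ℚ.≤-<-trans (split (seq x n) (seq x N))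
          (subst (∣ seq x n - seq x N ∣ + ∣ seq x N ∣ <_) (half+half ε)
            (ℚ.+-mono-< (ℚ.<-≤-trans (h (n , N) (N≤n , ℕ.≤-refl)) δ≤η) small)))
  ... | no big = inj₁ (δ , 0<δ , N , λ n N≤n → +-cancelʳ-≤ δ
          (subst₂ _≤_ (sym (half+half η)) (ℚ.+-comm δ ∣ seq x n ∣)
            (ℚ.≤-trans (ℚ.≮⇒≥ big)
              (ℚ.≤-trans (split (seq x N) (seq x n))
                (ℚ.+-monoˡ-≤ ∣ seq x n ∣ (ℚ.<⇒≤ (h (N , n) (ℕ.≤-refl , N≤n))))))))

tightℝ : ∀ x → ¬ Away (seq x) → Null (seq x)
tightℝ x ¬away ε 0<ε with away-or-small x ε 0<ε
... | inj₁ away  = contradiction away ¬away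
... | inj₂ small = small

away-+ : ∀ x y → Away (seq (x +ℝ y)) → Away (seq x) ⊎ Away (seq y)
away-+ x y (ε , 0<ε , h)
  with away-or-small x (½ ℚ.* ε) (half-pos 0<ε) | away-or-small y (½ ℚ.* ε) (half-pos 0<ε)
... | inj₁ a | _      = inj₁ a
... | inj₂ _ | inj₁ b = inj₂ b
... | inj₂ a | inj₂ b = contradiction (proj₂ none _ ℕ.≤-refl) (λ lt → ℚ.<-irrefl refl lt)
  where
  open Data.Rational
  sum-small : Eventually λ n → ∣ seq x n + seq y n ∣ < ε
  sum-small = eventually₂
    (λ n p q → ℚ.≤-<-trans (ℚ.∣p+q∣≤∣p∣+∣q∣ (seq x n) (seq y n))
      (subst (∣ seq x n ∣ + ∣ seq y n ∣ <_) (half+half ε) (ℚ.+-mono-< p q))) a b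
  none : Eventually λ n → ε < ε
  none = eventually₂ (λ n p q → ℚ.≤-<-trans p q) h sum-small

-- Reciprocal on ℚ extended by 0 ↦ 0, so that it applies to every term.
recip : ℚ → ℚ
recip q with q ℚ.≟ 0ℚ
... | yes _   = 0ℚ
... | no q≢0 = (ℚ.1/ q) {{ℚ.≢-nonZero q≢0}}

recip-inverse : ∀ {q ε} → 0ℚ ℚ.< ε → ε ℚ.≤ ℚ.∣ q ∣ → q ℚ.* recip q ≡ 1ℚ
recip-inverse {q} 0<ε ε≤∣q∣ with q ℚ.≟ 0ℚ
... | yes refl = contradiction (ℚ.<-≤-trans 0<ε ε≤∣q∣) (ℚ.<-irrefl refl)
... | no q≢0  = ℚ.*-inverseʳ q {{ℚ.≢-nonZero q≢0}}

recipℝ : ∀ x → Away (seq x) → ℝ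
recipℝ x (ε , 0<ε , N , h) = mkℝ i (Double.null-cong (N , eq) nul)
  where
  open Data.Rational
  i : ℕ → ℚ
  i n = recip (seq x n)
  inverse : ∀ n → N ℕ.≤ n → seq x n * i n ≡ 1ℚ
  inverse n N≤n = recip-inverse 0<ε (h n N≤n)
  i-bounded : Bounded i
  i-bounded with divide 0<ε (ℚ.positive⁻¹ 1ℚ)
  ... | B , 0<B , εB≡1 = B , 0<B , N , λ n N≤n →
    ℚ.*-cancelˡ-≤-pos ε {{positive 0<ε}}
      (subst (ε * ∣ i n ∣ ≤_)
        (trans (sym (ℚ.∣p*q∣≡∣p∣*∣q∣ (seq x n) (i n)))
               (trans (cong ∣_∣ (inverse n N≤n)) (sym εB≡1)))
        (ℚ.*-monoʳ-≤-nonNeg ∣ i n ∣ {{ℚ.∣-∣-nonNeg (i n)}} (h n N≤n)))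
  nul : Double.Null λ (m , n) → i m * (i n * - (seq x m - seq x n))
  nul = Double.null-* (boundedˡ i-bounded)
          (Double.null-* (boundedʳ i-bounded) (Double.null-neg (cauchy x)))
  eq : ∀ (mn : ℕ × ℕ) → let m , n = mn in N ℕ.≤ m × N ℕ.≤ n →
       i m * (i n * - (seq x m - seq x n)) ≡ i m - i n
  eq (m , n) (N≤m , N≤n) = trans
    (solve 4 (λ a b p q → p :* (q :* (:- (a :- b))) := (b :* q) :* p :- (a :* p) :* q) refl
       (seq x m) (seq x n) (i m) (i n))
    (trans (cong₂ (λ s t → s * i m - t * i n) (inverse n N≤n) (inverse m N≤m))
           (cong₂ _-_ (ℚ.*-identityˡ (i m)) (ℚ.*-identityˡ (i n))))

recipℝ-inverse : ∀ x (a : Away (seq x)) →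
                 Eventually λ n → seq x n ℚ.* seq (recipℝ x a) n ≡ 1ℚ
recipℝ-inverse x (ε , 0<ε , N , h) = N , λ n N≤n → recip-inverse 0<ε (h n N≤n)

infix 5 _+i_

record ℂ : Set where
  constructor _+i_
  field
    re im : ℝ

open ℂ public

infix 4 _≈ℂ_ _#ℂ_
infixl 6 _+ℂ_
infixl 7 _*ℂ_
infix  8 -ℂ_

_≈ℂ_ : ℂ → ℂ → Set
z ≈ℂ w = re z ≈ℝ re w × im z ≈ℝ im w

_#ℂ_ : ℂ → ℂ → Set
z #ℂ w = re z #ℝ re w ⊎ im z #ℝ im w

_+ℂ_ : ℂ → ℂ → ℂ
z +ℂ w = (re z +ℝ re w) +i (im z +ℝ im w)

_*ℂ_ : ℂ → ℂ → ℂ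
z *ℂ w = (re z *ℝ re w +ℝ (-ℝ (im z *ℝ im w))) +i (re z *ℝ im w +ℝ im z *ℝ re w)

-ℂ_ : ℂ → ℂ
-ℂ z = (-ℝ re z) +i (-ℝ im z)

0ℂ 1ℂ : ℂ
0ℂ = constℝ 0ℚ +i constℝ 0ℚ
1ℂ = constℝ 1ℚ +i constℝ 0ℚ

private
  pointwise : ∀ z w → (∀ n → seq (re z) n ≡ seq (re w) n) →
              (∀ n → seq (im z) n ≡ seq (im w) n) → z ≈ℂ w
  pointwise z w p q =
    ≈ℝ-pointwise (re z) (re w) (0 , λ n _ → p n) , ≈ℝ-pointwise (im z) (im w) (0 , λ n _ → q n)

  ≈ℂ-sym : ∀ z w → z ≈ℂ w → w ≈ℂ z
  ≈ℂ-sym z w (p , q) = ≈ℝ-sym (re z) (re w) p , ≈ℝ-sym (im z) (im w) q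

  ≈ℂ-trans : ∀ z w v → z ≈ℂ w → w ≈ℂ v → z ≈ℂ v
  ≈ℂ-trans z w v (p , q) (p′ , q′) =
    ≈ℝ-trans (re z) (re w) (re v) p p′ , ≈ℝ-trans (im z) (im w) (im v) q q′

  +ℂ-cong : ∀ z z′ w w′ → z ≈ℂ z′ → w ≈ℂ w′ → z +ℂ w ≈ℂ z′ +ℂ w′
  +ℂ-cong z z′ w w′ (p , q) (p′ , q′) =
    +ℝ-cong (re z) (re z′) (re w) (re w′) p p′ , +ℝ-cong (im z) (im z′) (im w) (im w′) q q′

  *ℂ-cong : ∀ z z′ w w′ → z ≈ℂ z′ → w ≈ℂ w′ → z *ℂ w ≈ℂ z′ *ℂ w′
  *ℂ-cong (a +i b) (a′ +i b′) (c +i d) (c′ +i d′) (p , q) (p′ , q′) =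
    +ℝ-cong (a *ℝ c) (a′ *ℝ c′) (-ℝ (b *ℝ d)) (-ℝ (b′ *ℝ d′)) (*ℝ-cong a a′ c c′ p p′)
      (-ℝ-cong (b *ℝ d) (b′ *ℝ d′) (*ℝ-cong b b′ d d′ q q′)) ,
    +ℝ-cong (a *ℝ d) (a′ *ℝ d′) (b *ℝ c) (b′ *ℝ c′)
      (*ℝ-cong a a′ d d′ p q′) (*ℝ-cong b b′ c c′ q p′)

  *ℂ-comm : ∀ z w → z *ℂ w ≈ℂ w *ℂ z
  *ℂ-comm z w = pointwise (z *ℂ w) (w *ℂ z)
    (λ n → solve 4 (λ a b c d → a :* c :+ (:- (b :* d)) := c :* a :+ (:- (d :* b))) refl
             (seq (re z) n) (seq (im z) n) (seq (re w) n) (seq (im w) n))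
    (λ n → solve 4 (λ a b c d → a :* d :+ b :* c := c :* b :+ d :* a) refl
             (seq (re z) n) (seq (im z) n) (seq (re w) n) (seq (im w) n))

  *ℂ-assoc : ∀ z w v → (z *ℂ w) *ℂ v ≈ℂ z *ℂ (w *ℂ v)
  *ℂ-assoc z w v = pointwise ((z *ℂ w) *ℂ v) (z *ℂ (w *ℂ v))
    (λ n → solve 6 (λ a b c d e f →
        (a :* c :+ (:- (b :* d))) :* e :+ (:- ((a :* d :+ b :* c) :* f))
        := a :* (c :* e :+ (:- (d :* f))) :+ (:- (b :* (c :* f :+ d :* e)))) refl
      (seq (re z) n) (seq (im z) n) (seq (re w) n) (seq (im w) n) (seq (re v) n) (seq (im v) n))
    (λ n → solve 6 (λ a b c d e f →
        (a :* c :+ (:- (b :* d))) :* f :+ (a :* d :+ b :* c) :* e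
        := a :* (c :* f :+ d :* e) :+ b :* (c :* e :+ (:- (d :* f)))) refl
      (seq (re z) n) (seq (im z) n) (seq (re w) n) (seq (im w) n) (seq (re v) n) (seq (im v) n))

  *ℂ-identityˡ : ∀ z → 1ℂ *ℂ z ≈ℂ z
  *ℂ-identityˡ z = pointwise (1ℂ *ℂ z) z
    (λ n → solve 2 (λ a b → con 1ℚ :* a :+ (:- (con 0ℚ :* b)) := a) refl
             (seq (re z) n) (seq (im z) n))
    (λ n → solve 2 (λ a b → con 1ℚ :* b :+ con 0ℚ :* a := b) refl
             (seq (re z) n) (seq (im z) n))

  *ℂ-identityʳ : ∀ z → z *ℂ 1ℂ ≈ℂ z
  *ℂ-identityʳ z = ≈ℂ-trans (z *ℂ 1ℂ) (1ℂ *ℂ z) z (*ℂ-comm z 1ℂ) (*ℂ-identityˡ z)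

  *ℂ-distribˡ : ∀ z w v → z *ℂ (w +ℂ v) ≈ℂ z *ℂ w +ℂ z *ℂ v
  *ℂ-distribˡ z w v = pointwise (z *ℂ (w +ℂ v)) (z *ℂ w +ℂ z *ℂ v)
    (λ n → solve 6 (λ a b c d e f →
        a :* (c :+ e) :+ (:- (b :* (d :+ f)))
        := (a :* c :+ (:- (b :* d))) :+ (a :* e :+ (:- (b :* f)))) refl
      (seq (re z) n) (seq (im z) n) (seq (re w) n) (seq (im w) n) (seq (re v) n) (seq (im v) n))
    (λ n → solve 6 (λ a b c d e f →
        a :* (d :+ f) :+ b :* (c :+ e) := (a :* d :+ b :* c) :+ (a :* f :+ b :* e)) refl
      (seq (re z) n) (seq (im z) n) (seq (re w) n) (seq (im w) n) (seq (re v) n) (seq (im v) n))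

  *ℂ-distribʳ : ∀ z w v → (w +ℂ v) *ℂ z ≈ℂ w *ℂ z +ℂ v *ℂ z
  *ℂ-distribʳ z w v =
    ≈ℂ-trans ((w +ℂ v) *ℂ z) (z *ℂ (w +ℂ v)) (w *ℂ z +ℂ v *ℂ z) (*ℂ-comm (w +ℂ v) z)
      (≈ℂ-trans (z *ℂ (w +ℂ v)) (z *ℂ w +ℂ z *ℂ v) (w *ℂ z +ℂ v *ℂ z) (*ℂ-distribˡ z w v)
        (+ℂ-cong (z *ℂ w) (w *ℂ z) (z *ℂ v) (v *ℂ z) (*ℂ-comm z w) (*ℂ-comm z v)))

  cotransℝ : ∀ x y → x #ℝ y → ∀ z → x #ℝ z ⊎ z #ℝ y
  cotransℝ x y x#y z = away-+ (x +ℝ (-ℝ z)) (z +ℝ (-ℝ y)) (away-ext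
    (λ n → solve 3 (λ a b c → a :- b := (a :- c) :+ (c :- b)) refl
             (seq x n) (seq y n) (seq z n)) x#y)

  symℝ : ∀ x y → x #ℝ y → y #ℝ x
  symℝ x y x#y = away-ext
    (λ n → solve 2 (λ a b → :- (a :- b) := b :- a) refl (seq x n) (seq y n)) (away-neg x#y)

  #ℂ-cotrans : ∀ z w → z #ℂ w → ∀ v → z #ℂ v ⊎ v #ℂ w
  #ℂ-cotrans z w (inj₁ p) v =
    [ inj₁ ∘ inj₁ , inj₂ ∘ inj₁ ]′ (cotransℝ (re z) (re w) p (re v))
  #ℂ-cotrans z w (inj₂ p) v =
    [ inj₁ ∘ inj₂ , inj₂ ∘ inj₂ ]′ (cotransℝ (im z) (im w) p (im v))

  0≤p*p : ∀ p → 0ℚ ℚ.≤ p ℚ.* p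
  0≤p*p p with ℚ.≤-total 0ℚ p
  ... | inj₁ 0≤p = subst (ℚ._≤ p ℚ.* p) (ℚ.*-zeroʳ p)
        (ℚ.*-monoˡ-≤-nonNeg p {{ℚ.nonNegative 0≤p}} 0≤p)
  ... | inj₂ p≤0 = subst (ℚ._≤ p ℚ.* p) (ℚ.*-zeroʳ p)
        (ℚ.*-monoˡ-≤-nonPos p {{ℚ.nonPositive p≤0}} p≤0)

  ∣p∣*∣p∣≡p*p : ∀ p → ℚ.∣ p ∣ ℚ.* ℚ.∣ p ∣ ≡ p ℚ.* p
  ∣p∣*∣p∣≡p*p p = trans (sym (ℚ.∣p*q∣≡∣p∣*∣q∣ p p)) (ℚ.0≤p⇒∣p∣≡p (0≤p*p p))

  away-square+ : ∀ x y → Away (seq x) → Away (seq (x *ℝ x +ℝ y *ℝ y))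
  away-square+ x y (ε , 0<ε , N , h) = ε * ε , 0<εε , N , bound
    where
    open Data.Rational
    instance
      ε-pos : Positive ε
      ε-pos = positive 0<ε
    0<εε : 0ℚ < ε * ε
    0<εε = subst (_< ε * ε) (ℚ.*-zeroʳ ε) (ℚ.*-monoʳ-<-pos ε 0<ε)
    bound : ∀ n → N ℕ.≤ n → ε * ε ≤ ∣ seq x n * seq x n + seq y n * seq y n ∣
    bound n N≤n = subst (ε * ε ≤_) (sym (ℚ.0≤p⇒∣p∣≡p (ℚ.≤-trans (0≤p*p a) a²≤)))
      (ℚ.≤-trans εε≤a² a²≤)
      where
      a b : ℚ
      a = seq x n
      b = seq y n
      a²≤ : a * a ≤ a * a + b * b
      a²≤ = subst (_≤ a * a + b * b) (ℚ.+-identityʳ (a * a)) (ℚ.+-monoʳ-≤ (a * a) (0≤p*p b))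
      εε≤a² : ε * ε ≤ a * a
      εε≤a² = subst (ε * ε ≤_) (∣p∣*∣p∣≡p*p a)
        (ℚ.≤-trans (ℚ.*-monoˡ-≤-nonNeg ε {{ℚ.pos⇒nonNeg ε}} (h n N≤n))
                   (ℚ.*-monoʳ-≤-nonNeg ∣ a ∣ {{ℚ.∣-∣-nonNeg a}} (h n N≤n)))

  normℝ : ℂ → ℝ
  normℝ z = re z *ℝ re z +ℝ im z *ℝ im z

  away-norm : ∀ z w → z #ℂ w → Away (seq (normℝ (z +ℂ (-ℂ w))))
  away-norm z w (inj₁ p) =
    away-square+ (re z +ℝ (-ℝ re w)) (im z +ℝ (-ℝ im w)) p
  away-norm z w (inj₂ p) = away-ext
    (λ n → ℚ.+-comm (seq ((im z +ℝ (-ℝ im w)) *ℝ (im z +ℝ (-ℝ im w))) n) _)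
    (away-square+ (im z +ℝ (-ℝ im w)) (re z +ℝ (-ℝ re w)) p)

  inverseʳ : ∀ z → Away (seq (normℝ z)) → ∃[ z⁻¹ ] z *ℂ z⁻¹ ≈ℂ 1ℂ
  inverseʳ z@(a +i b) away = z⁻¹ ,
    ≈ℝ-pointwise (re (z *ℂ z⁻¹)) (constℝ 1ℚ) (let (N , h) = recipℝ-inverse (normℝ z) away in
      N , λ n N≤n → trans
        (solve 3 (λ a b i → a :* (a :* i) :+ (:- (b :* ((:- b) :* i)))
                            := (a :* a :+ b :* b) :* i) refl (seq a n) (seq b n) (seq i n))
        (h n N≤n)) ,
    ≈ℝ-pointwise (im (z *ℂ z⁻¹)) (constℝ 0ℚ) (0 , λ n _ →
      solve 3 (λ a b i → a :* ((:- b) :* i) :+ b :* (a :* i) := con 0ℚ) refl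
        (seq a n) (seq b n) (seq i n))
    where
    i : ℝ
    i = recipℝ (normℝ z) away
    z⁻¹ : ℂ
    z⁻¹ = (a *ℝ i) +i ((-ℝ b) *ℝ i)

  away-1 : Away λ _ → 1ℚ
  away-1 = 1ℚ , ℚ.positive⁻¹ 1ℚ , 0 , λ _ _ → ℚ.≤-refl

  inverse⇒away : ∀ u z → u *ℂ z ≈ℂ 1ℂ → Away (seq (re z)) ⊎ Away (seq (im z))
  inverse⇒away (c +i d) (a +i b) (p , _) =
    [ inj₁ ∘ away-factor (bounded c) , inj₂ ∘ away-factor (bounded d) ∘ neg⁻ ]′
      (away-+ (c *ℝ a) (-ℝ (d *ℝ b)) (away-ext
        (λ n → solve 1 (λ s → con 1ℚ :+ (s :- con 1ℚ) := s) refl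
                 (seq (c *ℝ a +ℝ (-ℝ (d *ℝ b))) n))
        (away+null away-1 p)))
    where
    neg⁻ : Away (seq (-ℝ (d *ℝ b))) → Away (seq (d *ℝ b))
    neg⁻ q = away-ext (λ n → solve 1 (λ s → :- (:- s) := s) refl (seq (d *ℝ b) n)) (away-neg q)

ℂ-heytingField : HeytingField 0ℓ 0ℓ 0ℓ
ℂ-heytingField = record
  { Carrier = ℂ ; _≈_ = _≈ℂ_ ; _#_ = _#ℂ_ ; _+_ = _+ℂ_ ; _*_ = _*ℂ_ ; -_ = -ℂ_
  ; 0# = 0ℂ ; 1# = 1ℂ
  ; isHeytingField = record
    { isHeytingCommutativeRing = record
      { isCommutativeRing = record
        { isRing = record
          { +-isAbelianGroup = record
            { isGroup = record
              { isMonoid = record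
                { isSemigroup = record
                  { isMagma = record
                    { isEquivalence = record
                      { refl  = λ {z} → ≈ℝ-refl (re z) , ≈ℝ-refl (im z)
                      ; sym   = λ {z} {w} → ≈ℂ-sym z w
                      ; trans = λ {z} {w} {v} → ≈ℂ-trans z w v
                      }
                    ; ∙-cong = λ {z} {z′} {w} {w′} → +ℂ-cong z z′ w w′
                    }
                  ; assoc = λ z w v → pointwise ((z +ℂ w) +ℂ v) (z +ℂ (w +ℂ v))
                      (λ n → ℚ.+-assoc (seq (re z) n) (seq (re w) n) (seq (re v) n))
                      (λ n → ℚ.+-assoc (seq (im z) n) (seq (im w) n) (seq (im v) n))
                  }
                ; identity =
                    (λ z → pointwise (0ℂ +ℂ z) z
                      (λ n → ℚ.+-identityˡ (seq (re z) n)) (λ n → ℚ.+-identityˡ (seq (im z) n)))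
                  , (λ z → pointwise (z +ℂ 0ℂ) z
                      (λ n → ℚ.+-identityʳ (seq (re z) n)) (λ n → ℚ.+-identityʳ (seq (im z) n)))
                }
              ; inverse =
                  (λ z → pointwise ((-ℂ z) +ℂ z) 0ℂ
                    (λ n → ℚ.+-inverseˡ (seq (re z) n)) (λ n → ℚ.+-inverseˡ (seq (im z) n)))
                , (λ z → pointwise (z +ℂ (-ℂ z)) 0ℂ
                    (λ n → ℚ.+-inverseʳ (seq (re z) n)) (λ n → ℚ.+-inverseʳ (seq (im z) n)))
              ; ⁻¹-cong = λ {z} {w} (p , q) → -ℝ-cong (re z) (re w) p , -ℝ-cong (im z) (im w) q
              }
            ; comm = λ z w → pointwise (z +ℂ w) (w +ℂ z)
                (λ n → ℚ.+-comm (seq (re z) n) (seq (re w) n))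
                (λ n → ℚ.+-comm (seq (im z) n) (seq (im w) n))
            }
          ; *-cong     = λ {z} {z′} {w} {w′} → *ℂ-cong z z′ w w′
          ; *-assoc    = *ℂ-assoc
          ; *-identity = *ℂ-identityˡ , *ℂ-identityʳ
          ; distrib    = *ℂ-distribˡ , *ℂ-distribʳ
          }
        ; *-comm = *ℂ-comm
        }
      ; isApartnessRelation = record
        { irrefl  = λ { (p , q) → [ (λ a → away⇒¬null a p) , (λ a → away⇒¬null a q) ]′ }
        ; sym     = λ { {z} {w} (inj₁ p) → inj₁ (symℝ (re z) (re w) p)
                      ; {z} {w} (inj₂ p) → inj₂ (symℝ (im z) (im w) p) }
        ; cotrans = λ {z} {w} → #ℂ-cotrans z w
        }
      ; #⇒invertible = λ {z} {w} z#w →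
          let d = z +ℂ (-ℂ w)
              (d⁻¹ , p) = inverseʳ d (away-norm z w z#w)
          in d⁻¹ , ≈ℂ-trans (d⁻¹ *ℂ d) (d *ℂ d⁻¹) 1ℂ (*ℂ-comm d⁻¹ d) p , p
      ; invertible⇒# = λ {z} {w} (u , p , _) → inverse⇒away u (z +ℂ (-ℂ w)) p
      }
    ; tight = λ z w →
        (λ ¬z#w → tightℝ (re z +ℝ (-ℝ re w)) (¬z#w ∘ inj₁)
                , tightℝ (im z +ℝ (-ℝ im w)) (¬z#w ∘ inj₂))
      , (λ { (p , q) → [ (λ a → away⇒¬null a p) , (λ a → away⇒¬null a q) ]′ })
    }
  }

data Label : Set where
  ① ② ③ ④ ⑤ ⑥ : Label

data CombLine : Set where
  ℓ₁₂₃ ℓ₁₅₆ ℓ₂₄₆ ℓ₃₄₅ : CombLine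

pattern 1st = zero
pattern 2nd = suc zero
pattern 3rd = suc (suc zero)

-- The points P_ℓ¹, P_ℓ², P_ℓ³ on ℓ, in increasing order.
on : CombLine → Fin 3 → Label
on ℓ₁₂₃ = λ { 1st → ① ; 2nd → ② ; 3rd → ③ }
on ℓ₁₅₆ = λ { 1st → ① ; 2nd → ⑤ ; 3rd → ⑥ }
on ℓ₂₄₆ = λ { 1st → ② ; 2nd → ④ ; 3rd → ⑥ }
on ℓ₃₄₅ = λ { 1st → ③ ; 2nd → ④ ; 3rd → ⑤ }

-- The points P_m¹, P_m², P_m³ off ℓ; `off-spec` checks the labelling.
off : CombLine → Fin 3 → Label
off ℓ₁₂₃ = λ { 1st → ⑤ ; 2nd → ⑥ ; 3rd → ④ }
off ℓ₁₅₆ = λ { 1st → ② ; 2nd → ③ ; 3rd → ④ }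
off ℓ₂₄₆ = λ { 1st → ① ; 2nd → ③ ; 3rd → ⑤ }
off ℓ₃₄₅ = λ { 1st → ① ; 2nd → ② ; 3rd → ⑥ }

_∈ᶜ_ : Label → CombLine → Set
a ∈ᶜ ℓ = ∃[ i ] on ℓ i ≡ a

off-spec : ∀ ℓ → ∃[ a ] ∃[ b ] ∃[ c ]
  (ℓ ≢ a × ℓ ≢ b × ℓ ≢ c × a ≢ b × a ≢ c × b ≢ c) ×
  (on ℓ 1st ∈ᶜ a × off ℓ 1st ∈ᶜ a × off ℓ 2nd ∈ᶜ a) ×
  (on ℓ 2nd ∈ᶜ b × off ℓ 2nd ∈ᶜ b × off ℓ 3rd ∈ᶜ b) ×
  (on ℓ 3rd ∈ᶜ c × off ℓ 1st ∈ᶜ c × off ℓ 3rd ∈ᶜ c)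
off-spec ℓ₁₂₃ = ℓ₁₅₆ , ℓ₂₄₆ , ℓ₃₄₅ , ((λ ()) , (λ ()) , (λ ()) , (λ ()) , (λ ()) , (λ ())) ,
  ((1st , refl) , (2nd , refl) , (3rd , refl)) ,
  ((1st , refl) , (3rd , refl) , (2nd , refl)) ,
  ((1st , refl) , (3rd , refl) , (2nd , refl))
off-spec ℓ₁₅₆ = ℓ₁₂₃ , ℓ₃₄₅ , ℓ₂₄₆ , ((λ ()) , (λ ()) , (λ ()) , (λ ()) , (λ ()) , (λ ())) ,
  ((1st , refl) , (2nd , refl) , (3rd , refl)) ,
  ((3rd , refl) , (1st , refl) , (2nd , refl)) ,
  ((3rd , refl) , (1st , refl) , (2nd , refl))
off-spec ℓ₂₄₆ = ℓ₁₂₃ , ℓ₃₄₅ , ℓ₁₅₆ , ((λ ()) , (λ ()) , (λ ()) , (λ ()) , (λ ()) , (λ ())) ,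
  ((2nd , refl) , (1st , refl) , (3rd , refl)) ,
  ((2nd , refl) , (1st , refl) , (3rd , refl)) ,
  ((3rd , refl) , (1st , refl) , (2nd , refl))
off-spec ℓ₃₄₅ = ℓ₁₂₃ , ℓ₂₄₆ , ℓ₁₅₆ , ((λ ()) , (λ ()) , (λ ()) , (λ ()) , (λ ()) , (λ ())) ,
  ((3rd , refl) , (1st , refl) , (2nd , refl)) ,
  ((2nd , refl) , (1st , refl) , (3rd , refl)) ,
  ((2nd , refl) , (1st , refl) , (3rd , refl))

-- Inequations in the projective plane are expressed by the apartness
-- relation of the field, which for ℂ is classically the negation of ≈.
-- A Point (or Line) carries its chosen homogeneous coordinates.

module ProjectivePlane {c ℓ₁ ℓ₂} (K : HeytingField c ℓ₁ ℓ₂) where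
  open HeytingField K hiding (refl; sym; trans; zero)
  open CommutativeRing (HeytingCommutativeRing.commutativeRing heytingCommutativeRing)
    using (+-commutativeMonoid)
  open CommutativeMonoidSum +-commutativeMonoid using (sum)

  Vec³ : Set c
  Vec³ = Vector Carrier 3

  Nonzero : Vec³ → Set ℓ₂
  Nonzero v = ∃[ i ] v i # 0#

  infix 4 _∼_ _≁_ _∈_ _∉_ _≠_ _≠ᴸ_

  _∼_ : Vec³ → Vec³ → Set (c ⊔ ℓ₁ ⊔ ℓ₂)
  u ∼ v = ∃[ k ] k # 0# × (∀ i → u i ≈ k * v i)

  -- The negation of _∼_, with the failure of each equation u ≈ k v
  -- witnessed by a coordinate.
  _≁_ : Vec³ → Vec³ → Set (c ⊔ ℓ₂)
  u ≁ v = ∀ k → k # 0# → ∃[ i ] u i # k * v i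

  record Point : Set (c ⊔ ℓ₂) where
    constructor mkPoint
    field
      coords  : Vec³
      nonzero : Nonzero coords

  record Line : Set (c ⊔ ℓ₂) where
    constructor mkLine
    field
      coeffs  : Vec³
      nonzero : Nonzero coeffs

  open Point using (coords) public
  open Line using (coeffs) public

  _≠_ : Point → Point → Set (c ⊔ ℓ₂)
  p ≠ q = coords p ≁ coords q

  _≠ᴸ_ : Line → Line → Set (c ⊔ ℓ₂)
  l ≠ᴸ m = coeffs l ≁ coeffs m

  eval : Line → Point → Carrier
  eval l p = sum λ i → coeffs l i * coords p i

  _∈_ : Point → Line → Set ℓ₁
  p ∈ l = eval l p ≈ 0#

  _∉_ : Point → Line → Set ℓ₂
  p ∉ l = eval l p # 0#

  _Represents_ : Vec³ → Point → Set (c ⊔ ℓ₁ ⊔ ℓ₂)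
  v Represents p = v ∼ coords p

  -- Contrapositive form of "Σ aⱼ wⱼ = 0 implies a = 0".
  LinearlyIndependent : Vector Vec³ 3 → Set (c ⊔ ℓ₂)
  LinearlyIndependent w = ∀ (a : Vec³) → Nonzero a → Nonzero λ i → sum λ j → a j * w j i

  IsFrame : (Fin 3 → Point) → Point → Set (c ⊔ ℓ₁ ⊔ ℓ₂)
  IsFrame R U = ∃[ w ] (∀ j → w j Represents R j) × LinearlyIndependent w ×
                       (λ i → sum λ j → w j i) Represents U

  det : Vec³ → Vec³ → Vec³ → Carrier
  det u v w =
      u 1st * (v 2nd * w 3rd - v 3rd * w 2nd)
    - v 1st * (u 2nd * w 3rd - u 3rd * w 2nd)
    + w 1st * (u 2nd * v 3rd - u 3rd * v 2nd)

  [_∣_∣_] : Point → Point → Point → Carrier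
  [ p ∣ q ∣ s ] = det (coords p) (coords q) (coords s)

  record QuadrilateralSet : Set (c ⊔ ℓ₁ ⊔ ℓ₂) where
    field
      line            : CombLine → Line
      point           : Label → Point
      incident        : ∀ ℓ i → point (on ℓ i) ∈ line ℓ
      lines-distinct  : ∀ ℓ m → ℓ ≢ m → line ℓ ≠ᴸ line m
      points-distinct : ∀ a b → a ≢ b → point a ≠ point b

  -- The projection from P onto r maps q to x, i.e. q is different from
  -- P and x is a common point of r and the line joining P and q.
  ProjectsTo : Point → Line → Point → Point → Set (c ⊔ ℓ₁ ⊔ ℓ₂)
  ProjectsTo P r q x = q ≠ P × (∃[ l ] P ∈ l × q ∈ l × x ∈ l) × x ∈ r

  IsProjectedQuadrilateralSet : Line → (Label → Point) → Set (c ⊔ ℓ₁ ⊔ ℓ₂)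
  IsProjectedQuadrilateralSet r x = ∃[ P ] P ∉ r × ∃[ Q ]
    (∀ a → ProjectsTo P r (QuadrilateralSet.point Q a) (x a))

  QS : (Label → Point) → CombLine → Point → Point → Point → Carrier
  QS x ℓ P¹ P² P³ =
      [ p 1st ∣ m 1st ∣ P¹ ] * [ p 2nd ∣ m 2nd ∣ P² ] * [ p 3rd ∣ m 3rd ∣ P³ ]
    - [ p 1st ∣ m 2nd ∣ P¹ ] * [ p 2nd ∣ m 3rd ∣ P² ] * [ p 3rd ∣ m 1st ∣ P³ ]
    where
    p m : Fin 3 → Point
    p i = x (on ℓ i)
    m i = x (off ℓ i)

open ProjectivePlane ℂ-heytingField public

AllEquivalent : ∀ {n} → Vec Set n → Set
AllEquivalent Ps = ∀ i j → lookup Ps i ⇔ lookup Ps j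

{-# OPTIONS --safe #-}
module Submission where

-- For points a, b of r the bracket [a b P] is [a b W] scaled by r(P) / r(W), so
-- QS(ℓ; P¹, P², P³) is QS(ℓ; W, W, W) times r(P¹) r(P²) r(P³) / r(W)³: for a
-- fixed ℓ, all these polynomials vanish as soon as QS(ℓ; W, W, W) does for one
-- W off r. Some R_j is off r, so (v) yields such a W for ℓ₁₂₃. The points are
-- then lifted along the lines through W, with 1, 2, 3 staying in place, and
-- QS(ℓ₁₂₃; W, W, W) = 0 is the condition for the lifts of {1,5,6}, {2,4,6},
-- {3,4,5} to be collinear. Conversely, if the points are projected from P, they
-- are the projections of the intersections L × M of the four lines, and
-- det(A × B, A × C, P) = det(A, B, C) A(P) makes the two terms of
-- QS(ℓ; P, P, P) equal for every ℓ.

open import Algebra.Apartness.Bundles using (HeytingField; HeytingCommutativeRing)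
open import Algebra.Bundles using (CommutativeRing)
open import Algebra.Solver.Ring.AlmostCommutativeRing
  using (fromCommutativeRing; _-Raw-AlmostCommutative⟶_)
open import Data.Fin using (Fin; zero; suc; combine; _↑ˡ_; _↑ʳ_; _≤_)
open import Data.Fin.Properties using (≤-refl)
open import Data.Integer as ℤ using (ℤ; +_; -[1+_]; _⊖_)
import Data.Integer.Properties as ℤ
open import Data.Maybe using (map)
open import Data.Nat as ℕ using (ℕ; zero; suc)
import Data.Nat.Properties as ℕ
open import Data.Product using (∃-syntax; _×_; _,_; proj₁; proj₂)
open import Data.Sum using (_⊎_; inj₁; inj₂; [_,_]′)
open import Data.Vec as Vec using (Vec; _∷_; []; _++_; concat; tabulate)
open import Data.Vec.Functional using (Vector)
open import Defs using
  ( module ProjectivePlane; Label; ①; ②; ③; ④; ⑤; ⑥; CombLine; ℓ₁₂₃; ℓ₁₅₆; ℓ₂₄₆; ℓ₃₄₅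
  ; on; off; _∈ᶜ_; off-spec; 1st; 2nd; 3rd )
open import Function using (mk⇔; _∘_)
open import Relation.Binary.PropositionalEquality as ≡ using (_≡_; _≢_)
open import Relation.Nullary using (contradiction)
open import Relation.Nullary.Decidable using (dec⇒maybe)

-- A polynomial solver with integer coefficients

-- The coefficients are integers because an abstract ring has no decidable
-- equality, without which the solver could not cancel.
module IntegerRingSolver {c ℓ} (R : CommutativeRing c ℓ) where
  open CommutativeRing R
  open import Algebra.Properties.Ring ring
    using (-0#≈0#; -‿involutive; -‿distribˡ-*; -‿distribʳ-*; -‿+-comm)
  open import Algebra.Properties.Semiring.Mult semiring
    using (×-homo-+; ×1-homo-*) renaming (_×_ to _×ₙ_)
  open import Relation.Binary.Reasoning.Setoid setoid
  open import Algebra.Properties.CommutativeSemigroup +-commutativeSemigroup using (interchange)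

  fromℤ : ℤ → Carrier
  fromℤ (+ n)    = n ×ₙ 1#
  fromℤ -[1+ n ] = - (suc n ×ₙ 1#)

  fromℤ-neg : ∀ i → fromℤ (ℤ.- i) ≈ - fromℤ i
  fromℤ-neg (+ zero)  = sym -0#≈0#
  fromℤ-neg (+ suc n) = refl
  fromℤ-neg -[1+ n ]  = sym (-‿involutive _)

  fromℤ-⊖ : ∀ m n → fromℤ (m ⊖ n) ≈ m ×ₙ 1# - n ×ₙ 1#
  fromℤ-⊖ m       zero    = sym (trans (+-congˡ -0#≈0#) (+-identityʳ _))
  fromℤ-⊖ zero    (suc n) = sym (+-identityˡ _)
  fromℤ-⊖ (suc m) (suc n) = begin
    fromℤ (suc m ⊖ suc n)             ≡⟨ ≡.cong fromℤ (ℤ.[1+m]⊖[1+n]≡m⊖n m n) ⟩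
    fromℤ (m ⊖ n)                     ≈⟨ fromℤ-⊖ m n ⟩
    m ×ₙ 1# - n ×ₙ 1#                 ≈⟨ +-identityˡ _ ⟨
    0# + (m ×ₙ 1# - n ×ₙ 1#)          ≈⟨ +-congʳ (-‿inverseʳ 1#) ⟨
    (1# - 1#) + (m ×ₙ 1# - n ×ₙ 1#)   ≈⟨ interchange _ _ _ _ ⟩
    (1# + m ×ₙ 1#) + (- 1# - n ×ₙ 1#) ≈⟨ +-congˡ (-‿+-comm 1# (n ×ₙ 1#)) ⟩
    suc m ×ₙ 1# - suc n ×ₙ 1#         ∎

  fromℤ-+ : ∀ i j → fromℤ (i ℤ.+ j) ≈ fromℤ i + fromℤ j
  fromℤ-+ (+ m)    (+ n)    = ×-homo-+ 1# m n
  fromℤ-+ (+ m)    -[1+ n ] = fromℤ-⊖ m (suc n)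
  fromℤ-+ -[1+ m ] (+ n)    = trans (fromℤ-⊖ n (suc m)) (+-comm _ _)
  fromℤ-+ -[1+ m ] -[1+ n ] = begin
    - (suc (suc (m ℕ.+ n)) ×ₙ 1#)     ≡⟨ ≡.cong (λ k → fromℤ -[1+ k ]) (≡.sym (ℕ.+-suc m n)) ⟩
    - ((suc m ℕ.+ suc n) ×ₙ 1#)       ≈⟨ -‿cong (×-homo-+ 1# (suc m) (suc n)) ⟩
    - (suc m ×ₙ 1# + suc n ×ₙ 1#)     ≈⟨ -‿+-comm _ _ ⟨
    - (suc m ×ₙ 1#) - suc n ×ₙ 1#     ∎

  fromℤ-*⁺ : ∀ m j → fromℤ (+ m ℤ.* j) ≈ fromℤ (+ m) * fromℤ j
  fromℤ-*⁺ m (+ n)    = begin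
    fromℤ (+ m ℤ.* + n)               ≡⟨ ≡.cong fromℤ (ℤ.pos-* m n) ⟨
    (m ℕ.* n) ×ₙ 1#                   ≈⟨ ×1-homo-* m n ⟩
    m ×ₙ 1# * n ×ₙ 1#                 ∎
  fromℤ-*⁺ m j@(-[1+ n ]) = begin
    fromℤ (+ m ℤ.* j)                 ≡⟨ ≡.cong fromℤ (ℤ.neg-distribʳ-* (+ m) (+ suc n)) ⟨
    fromℤ (ℤ.- (+ m ℤ.* + suc n))     ≈⟨ fromℤ-neg (+ m ℤ.* + suc n) ⟩
    - fromℤ (+ m ℤ.* + suc n)         ≈⟨ -‿cong (fromℤ-*⁺ m (+ suc n)) ⟩
    - (m ×ₙ 1# * suc n ×ₙ 1#)         ≈⟨ -‿distribʳ-* _ _ ⟩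
    m ×ₙ 1# * - (suc n ×ₙ 1#)         ∎

  fromℤ-* : ∀ i j → fromℤ (i ℤ.* j) ≈ fromℤ i * fromℤ j
  fromℤ-* (+ m)        j = fromℤ-*⁺ m j
  fromℤ-* i@(-[1+ m ]) j = begin
    fromℤ (i ℤ.* j)                   ≡⟨ ≡.cong fromℤ (ℤ.neg-distribˡ-* (+ suc m) j) ⟨
    fromℤ (ℤ.- (+ suc m ℤ.* j))       ≈⟨ fromℤ-neg (+ suc m ℤ.* j) ⟩
    - fromℤ (+ suc m ℤ.* j)           ≈⟨ -‿cong (fromℤ-*⁺ (suc m) j) ⟩
    - (suc m ×ₙ 1# * fromℤ j)         ≈⟨ -‿distribˡ-* _ _ ⟩
    - (suc m ×ₙ 1#) * fromℤ j         ∎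

  fromℤ-morphism : ℤ.+-*-rawRing -Raw-AlmostCommutative⟶ fromCommutativeRing R
  fromℤ-morphism = record
    { ⟦_⟧    = fromℤ
    ; +-homo = fromℤ-+
    ; *-homo = fromℤ-*
    ; -‿homo = fromℤ-neg
    ; 0-homo = refl
    ; 1-homo = +-identityʳ 1#
    }

  open import Algebra.Solver.Ring ℤ.+-*-rawRing (fromCommutativeRing R) fromℤ-morphism
    (λ i j → map (λ i≡j → reflexive (≡.cong fromℤ i≡j)) (dec⇒maybe (i ℤ.≟ j)))
    public

module Plane {c ℓ₁ ℓ₂} (K : HeytingField c ℓ₁ ℓ₂) where
  open HeytingField K hiding (zero)
  open ProjectivePlane K

  commutativeRing : CommutativeRing c ℓ₁
  commutativeRing = HeytingCommutativeRing.commutativeRing heytingCommutativeRing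

  open CommutativeRing commutativeRing using (+-commutativeMonoid; +-group)
  open import Algebra.Apartness.Properties.HeytingCommutativeRing heytingCommutativeRing
    using (invertibleˡ⇒#; x-0≈x; x#0y#0→xy#0; #-congʳ; #-congˡ)
  open import Algebra.Properties.CommutativeMonoid.Sum +-commutativeMonoid using (sum; sum-cong-≋)
  open import Algebra.Properties.Group +-group using (x∙y⁻¹≈ε⇒x≈y)
  open import Relation.Binary.Reasoning.Setoid setoid
  open IntegerRingSolver commutativeRing

  -- Dot and cross products, and a solver for vector identities

  infixl 7 _·_ _⨯_

  _·_ : Vec³ → Vec³ → Carrier
  u · v = sum λ i → u i * v i

  _⨯_ : Vec³ → Vec³ → Vec³
  (u ⨯ v) 1st = u 2nd * v 3rd - u 3rd * v 2nd
  (u ⨯ v) 2nd = u 3rd * v 1st - u 1st * v 3rd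
  (u ⨯ v) 3rd = u 1st * v 2nd - u 2nd * v 1st

  e : Fin 3 → Vec³
  e 1st 1st     = 1#
  e 1st (suc _) = 0#
  e 2nd 1st     = 0#
  e 2nd 2nd     = 1#
  e 2nd 3rd     = 0#
  e 3rd 1st     = 0#
  e 3rd 2nd     = 0#
  e 3rd 3rd     = 1#

  infixl 10 _:·_ _:⨯_

  -- The trailing `con (+ 0)` mirrors the `0#` that ends `sum`, so that the denotation is `_·_`
  -- definitionally.
  _:·_ : ∀ {n} → Vector (Polynomial n) 3 → Vector (Polynomial n) 3 → Polynomial n
  u :· v = u 1st :* v 1st :+ (u 2nd :* v 2nd :+ (u 3rd :* v 3rd :+ con (+ 0)))

  _:⨯_ : ∀ {n} → Vector (Polynomial n) 3 → Vector (Polynomial n) 3 → Vector (Polynomial n) 3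
  (u :⨯ v) 1st = u 2nd :* v 3rd :- u 3rd :* v 2nd
  (u :⨯ v) 2nd = u 3rd :* v 1st :- u 1st :* v 3rd
  (u :⨯ v) 3rd = u 1st :* v 2nd :- u 2nd :* v 1st

  :det : ∀ {n} (u v w : Vector (Polynomial n) 3) → Polynomial n
  :det u v w =
       u 1st :* (v 2nd :* w 3rd :- v 3rd :* w 2nd)
    :- v 1st :* (u 2nd :* w 3rd :- u 3rd :* w 2nd)
    :+ w 1st :* (u 2nd :* v 3rd :- u 3rd :* v 2nd)

  -- The entry `k` is a parameter because `con (+ 1)` denotes `1# + 0#`; instantiating a scalar
  -- variable with `1#` matches `e` on the nose.
  :e : ∀ {n} → Fin 3 → Polynomial n → Vector (Polynomial n) 3
  :e 1st k 1st     = k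
  :e 1st k (suc _) = con (+ 0)
  :e 2nd k 1st     = con (+ 0)
  :e 2nd k 2nd     = k
  :e 2nd k 3rd     = con (+ 0)
  :e 3rd k 1st     = con (+ 0)
  :e 3rd k 2nd     = con (+ 0)
  :e 3rd k 3rd     = k

  -- The solver sees scalars only: the coordinates of the `k` vectors become consecutive blocks of
  -- three variables, followed by the `m` scalars, and `f` states the identity for symbolic vectors.
  module _ {k m : ℕ} (us : Vec Vec³ k) (as : Vec Carrier m)
           (f : Vec (Vector (Polynomial (k ℕ.* 3 ℕ.+ m)) 3) k → Vec (Polynomial (k ℕ.* 3 ℕ.+ m)) m →
                Polynomial (k ℕ.* 3 ℕ.+ m) × Polynomial (k ℕ.* 3 ℕ.+ m)) where

    environment : Vec Carrier (k ℕ.* 3 ℕ.+ m)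
    environment = concat (Vec.map tabulate us) ++ as

    sides : Polynomial (k ℕ.* 3 ℕ.+ m) × Polynomial (k ℕ.* 3 ℕ.+ m)
    sides = f (tabulate λ j i → var (combine j i ↑ˡ m)) (tabulate λ j → var (k ℕ.* 3 ↑ʳ j))

    vector-identity : ⟦ proj₁ sides ⟧↓ environment ≈ ⟦ proj₂ sides ⟧↓ environment →
                      ⟦ proj₁ sides ⟧ environment ≈ ⟦ proj₂ sides ⟧ environment
    vector-identity = prove environment (proj₁ sides) (proj₂ sides)

  -- Cramer's rule for `s` in terms of `a`, `b`, `t`, cleared of denominators and paired with a
  -- covector: `r = e i` recovers a coordinate, while a line through some of the points kills their
  -- terms.
  cramer : ∀ r a b t s → det a b t * (r · s) ≈
           det s b t * (r · a) + det a s t * (r · b) + det a b s * (r · t)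
  cramer r a b t s = vector-identity (r ∷ a ∷ b ∷ t ∷ s ∷ []) []
    (λ { (r ∷ a ∷ b ∷ t ∷ s ∷ []) _ → :det a b t :* (r :· s) ,
           :det s b t :* (r :· a) :+ :det a s t :* (r :· b) :+ :det a b s :* (r :· t) }) refl

  -- The Binet-Cauchy identity. For basis vectors `s`, `t` the right side is a 2 by 2 minor, which
  -- thereby becomes a determinant with a third column.
  lagrange : ∀ u v s t → det u v (s ⨯ t) ≈ (u · s) * (v · t) - (u · t) * (v · s)
  lagrange u v s t = vector-identity (u ∷ v ∷ s ∷ t ∷ []) []
    (λ { (u ∷ v ∷ s ∷ t ∷ []) _ → :det u v (s :⨯ t) ,
           (u :· s) :* (v :· t) :- (u :· t) :* (v :· s) }) refl

  -- The lines `a`, `b` and `a`, `c` meet in two points of `a`, and joining these gives back `a`,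
  -- with factor `det a b c`.
  det-⨯⨯ : ∀ a b c p → det (a ⨯ b) (a ⨯ c) p ≈ det a b c * (a · p)
  det-⨯⨯ a b c p = vector-identity (a ∷ b ∷ c ∷ p ∷ []) []
    (λ { (a ∷ b ∷ c ∷ p ∷ []) _ → :det (a :⨯ b) (a :⨯ c) p , :det a b c :* (a :· p) }) refl

  ⨯-· : ∀ u v w → (u ⨯ v) · w ≈ det u v w
  ⨯-· u v w = vector-identity (u ∷ v ∷ w ∷ []) []
    (λ { (u ∷ v ∷ w ∷ []) _ → (u :⨯ v) :· w , :det u v w }) refl

  det-cycle : ∀ u v w → det u v w ≈ det v w u
  det-cycle u v w = vector-identity (u ∷ v ∷ w ∷ []) []
    (λ { (u ∷ v ∷ w ∷ []) _ → :det u v w , :det v w u }) refl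

  det-swap-outer : ∀ u v w → det u v w ≈ - det w v u
  det-swap-outer u v w = vector-identity (u ∷ v ∷ w ∷ []) []
    (λ { (u ∷ v ∷ w ∷ []) _ → :det u v w , :- :det w v u }) refl

  det-repeated : ∀ u w → det u u w ≈ 0#
  det-repeated u w = vector-identity (u ∷ w ∷ []) []
    (λ { (u ∷ w ∷ []) _ → :det u u w , con (+ 0) }) refl

  ·-comm : ∀ u v → u · v ≈ v · u
  ·-comm u v = sum-cong-≋ λ i → *-comm (u i) (v i)

  ·-congˡ : ∀ u {v v′} → (∀ i → v i ≈ v′ i) → u · v ≈ u · v′
  ·-congˡ u v≈v′ = sum-cong-≋ λ i → *-congˡ {u i} (v≈v′ i)

  ·-e : ∀ u i → u · e i ≈ u i
  ·-e u i = trans (proj i) (*-identityʳ (u i))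
    where
    proj : ∀ i → u · e i ≈ u i * 1#
    proj 1st = vector-identity (u ∷ []) (1# ∷ []) (λ { (u ∷ []) (k ∷ []) → u :· :e 1st k , u 1st :* k }) refl
    proj 2nd = vector-identity (u ∷ []) (1# ∷ []) (λ { (u ∷ []) (k ∷ []) → u :· :e 2nd k , u 2nd :* k }) refl
    proj 3rd = vector-identity (u ∷ []) (1# ∷ []) (λ { (u ∷ []) (k ∷ []) → u :· :e 3rd k , u 3rd :* k }) refl

  e-· : ∀ i u → e i · u ≈ u i
  e-· i u = trans (·-comm (e i) u) (·-e u i)

  det-cong₁₂ : ∀ {u u′ v v′} w → (∀ i → u i ≈ u′ i) → (∀ i → v i ≈ v′ i) → det u v w ≈ det u′ v′ w
  det-cong₁₂ {u} {u′} {v} {v′} w u≈u′ v≈v′ = begin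
    det u v w       ≈⟨ det-cycle u v w ⟩
    det v w u       ≈⟨ ⨯-· v w u ⟨
    (v ⨯ w) · u     ≈⟨ ·-congˡ (v ⨯ w) u≈u′ ⟩
    (v ⨯ w) · u′    ≈⟨ ⨯-· v w u′ ⟩
    det v w u′      ≈⟨ det-cycle u′ v w ⟨
    det u′ v w      ≈⟨ det-cycle w u′ v ⟨
    det w u′ v      ≈⟨ ⨯-· w u′ v ⟨
    (w ⨯ u′) · v    ≈⟨ ·-congˡ (w ⨯ u′) v≈v′ ⟩
    (w ⨯ u′) · v′   ≈⟨ ⨯-· w u′ v′ ⟩
    det w u′ v′     ≈⟨ det-cycle w u′ v′ ⟩
    det u′ v′ w     ∎

  -- Apartness as invertibility of differences

  x-y#0⇒x#y : ∀ {x y} → x - y # 0# → x # y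
  x-y#0⇒x#y x-y#0 with #⇒invertible x-y#0
  ... | z , z*≈1 , _ = invertibleˡ⇒# (z , trans (*-congˡ (sym (x-0≈x _))) z*≈1)

  x#y⇒x-y#0 : ∀ {x y} → x # y → x - y # 0#
  x#y⇒x-y#0 x#y with #⇒invertible x#y
  ... | z , z*≈1 , _ = invertibleˡ⇒# (z , trans (*-congˡ (x-0≈x _)) z*≈1)

  left-inverse : ∀ {x} → x # 0# → ∃[ z ] z * x ≈ 1#
  left-inverse x#0 with #⇒invertible x#0
  ... | z , z*≈1 , _ = z , trans (*-congˡ (sym (x-0≈x _))) z*≈1

  left-inverse⇒#0 : ∀ {x} z → z * x ≈ 1# → x # 0#
  left-inverse⇒#0 z z*x≈1 = invertibleˡ⇒# (z , trans (*-congˡ (x-0≈x _)) z*x≈1)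

  x*y#0⇒y#0 : ∀ x {y} → x * y # 0# → y # 0#
  x*y#0⇒y#0 x {y} xy#0 with left-inverse xy#0
  ... | z , z*xy≈1 = left-inverse⇒#0 (z * x) (trans (*-assoc z x y) z*xy≈1)

  x*y#0⇒x#0 : ∀ {x} y → x * y # 0# → x # 0#
  x*y#0⇒x#0 y xy#0 = x*y#0⇒y#0 y (#-congʳ (*-comm _ y) xy#0)

  -x#0 : ∀ {x} → x # 0# → - x # 0#
  -x#0 {x} x#0 with left-inverse x#0
  ... | z , zx≈1 = left-inverse⇒#0 (- z)
    (trans (solve 2 (λ z x → (:- z) :* (:- x) := z :* x) refl z x) zx≈1)

  -- Cotransitivity places `x` between `x + y` and `0#`; being apart from the former makes `y` apart
  -- from zero.
  x+y#0⇒x#0⊎y#0 : ∀ x y → x + y # 0# → x # 0# ⊎ y # 0#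
  x+y#0⇒x#0⊎y#0 x y x+y#0 with #-cotrans x+y#0 x
  ... | inj₁ x+y#x = inj₂ (#-congʳ (solve 2 (λ x y → (x :+ y) :- x := y) refl x y) (x#y⇒x-y#0 x+y#x))
  ... | inj₂ x#0   = inj₁ x#0

  *-cancelˡ-0 : ∀ {x y} → x # 0# → x * y ≈ 0# → y ≈ 0#
  *-cancelˡ-0 {x} {y} x#0 xy≈0 with left-inverse x#0
  ... | z , zx≈1 = begin
    y             ≈⟨ *-identityˡ y ⟨
    1# * y        ≈⟨ *-congʳ zx≈1 ⟨
    z * x * y     ≈⟨ *-assoc z x y ⟩
    z * (x * y)   ≈⟨ *-congˡ xy≈0 ⟩
    z * 0#        ≈⟨ zeroʳ z ⟩
    0#            ∎

  sum#0⇒∃#0 : (u : Vec³) → sum u # 0# → Nonzero u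
  sum#0⇒∃#0 u s with x+y#0⇒x#0⊎y#0 (u 1st) _ s
  ... | inj₁ p = 1st , p
  ... | inj₂ t with x+y#0⇒x#0⊎y#0 (u 2nd) _ t
  ... | inj₁ p = 2nd , p
  ... | inj₂ p = 3rd , #-congʳ (+-identityʳ (u 3rd)) p

  -- The main source of `Nonzero` witnesses: a pairing apart from zero has a term apart from zero,
  -- which exhibits the coordinate.
  ·#0⇒Nonzeroˡ : ∀ u v → u · v # 0# → Nonzero u
  ·#0⇒Nonzeroˡ u v u·v#0 with sum#0⇒∃#0 (λ i → u i * v i) u·v#0
  ... | i , uv#0 = i , x*y#0⇒x#0 (v i) uv#0

  ·#0⇒Nonzeroʳ : ∀ u v → u · v # 0# → Nonzero v
  ·#0⇒Nonzeroʳ u v u·v#0 = ·#0⇒Nonzeroˡ v u (#-congʳ (·-comm u v) u·v#0)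

  det#0⇒Nonzero : ∀ u v w → det u v w # 0# → Nonzero u
  det#0⇒Nonzero u v w d = ·#0⇒Nonzeroʳ (v ⨯ w) u (#-congʳ (trans (det-cycle u v w) (sym (⨯-· v w u))) d)

  -- Distinct points and nonvanishing determinants

  det-shear : ∀ k u v w → det (λ i → u i - k * v i) v w ≈ det u v w
  det-shear k u v w = vector-identity (u ∷ v ∷ w ∷ []) (k ∷ [])
    (λ { (u ∷ v ∷ w ∷ []) (k ∷ []) → :det (λ i → u i :- k :* v i) v w , :det u v w }) refl

  -- Subtracting `k v` from the first column preserves the determinant, so `u - k v` still has a
  -- coordinate apart from zero.
  det#0⇒≁ : ∀ u v w → det u v w # 0# → u ≁ v
  det#0⇒≁ u v w d k _ =
    let i , p = det#0⇒Nonzero (λ i → u i - k * v i) v w (#-congʳ (sym (det-shear k u v w)) d)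
    in i , x-y#0⇒x#y p

  -- A nonvanishing minor is found by comparing uᵢ vⱼ with uⱼ vᵢ. If they are not
  -- visibly apart then uⱼ # 0, and u ≁ v applies to the ratio k = uⱼ / vⱼ.
  ≁⇒det#0 : ∀ u v → Nonzero u → Nonzero v → u ≁ v → ∃[ t ] det u v t # 0#
  ≁⇒det#0 u v (i , uᵢ#0) (j , vⱼ#0) u≁v =
    [ from-minor i j , (λ uⱼvᵢ#0 → ratio (x*y#0⇒x#0 (v i) uⱼvᵢ#0)) ]′
      (#-cotrans (x#0y#0→xy#0 uᵢ#0 vⱼ#0) (u j * v i))
    where
    minor : ∀ i j → det u v (e i ⨯ e j) ≈ u i * v j - u j * v i
    minor i j = trans (lagrange u v (e i) (e j))
      (+-cong (*-cong (·-e u i) (·-e v j)) (-‿cong (*-cong (·-e u j) (·-e v i))))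
    from-minor : ∀ i j → u i * v j # u j * v i → ∃[ t ] det u v t # 0#
    from-minor i j p = e i ⨯ e j , #-congʳ (sym (minor i j)) (x#y⇒x-y#0 p)
    ratio : u j # 0# → ∃[ t ] det u v t # 0#
    ratio uⱼ#0 with left-inverse vⱼ#0
    ... | z , zvⱼ≈1 with u≁v (u j * z) (x#0y#0→xy#0 uⱼ#0 (left-inverse⇒#0 (v j) (trans (*-comm _ _) zvⱼ≈1)))
    ... | m , uₘ#kvₘ = from-minor m j (x-y#0⇒x#y (#-congʳ scaled (x#0y#0→xy#0 (x#y⇒x-y#0 uₘ#kvₘ) vⱼ#0)))
      where
      scaled : (u m - u j * z * v m) * v j ≈ u m * v j - u j * v m
      scaled = begin
        (u m - u j * z * v m) * v j
          ≈⟨ solve 5 (λ a b z c d → (a :- b :* z :* c) :* d := a :* d :- (z :* d) :* (b :* c)) refl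
               (u m) (u j) z (v m) (v j) ⟩
        u m * v j - z * v j * (u j * v m)   ≈⟨ +-congˡ (-‿cong (*-congʳ zvⱼ≈1)) ⟩
        u m * v j - 1# * (u j * v m)        ≈⟨ +-congˡ (-‿cong (*-identityˡ _)) ⟩
        u m * v j - u j * v m               ∎

  -- Brackets of points on a common line

  cramer-on : ∀ r a b t s → r · a ≈ 0# → r · b ≈ 0# → det a b t * (r · s) ≈ det a b s * (r · t)
  cramer-on r a b t s ra≈0 rb≈0 = begin
    det a b t * (r · s)
      ≈⟨ cramer r a b t s ⟩
    det s b t * (r · a) + det a s t * (r · b) + det a b s * (r · t)
      ≈⟨ +-congʳ (+-cong (*-congˡ ra≈0) (*-congˡ rb≈0)) ⟩
    det s b t * 0# + det a s t * 0# + det a b s * (r · t)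
      ≈⟨ solve 3 (λ x y z → x :* con (+ 0) :+ y :* con (+ 0) :+ z := z) refl _ _ _ ⟩
    det a b s * (r · t) ∎

  -- Exchanging `c` for a basis vector `e m` with `l m` apart from zero brings out the factor
  -- `l · c`, which vanishes.
  collinear⇒det≈0 : ∀ l a b c → Nonzero l → l · a ≈ 0# → l · b ≈ 0# → l · c ≈ 0# → det a b c ≈ 0#
  collinear⇒det≈0 l a b c (m , lₘ#0) la lb lc = *-cancelˡ-0 lₘ#0 (begin
    l m * det a b c         ≈⟨ *-comm _ _ ⟩
    det a b c * l m         ≈⟨ *-congˡ (·-e l m) ⟨
    det a b c * (l · e m)   ≈⟨ cramer-on l a b c (e m) la lb ⟩
    det a b (e m) * (l · c) ≈⟨ *-congˡ lc ⟩
    det a b (e m) * 0#      ≈⟨ zeroʳ _ ⟩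
    0#                      ∎)

  *-rescale : ∀ {a₁ a₂ a₃ b₁ b₂ b₃ s t₁ t₂ t₃ : Carrier} →
    a₁ * t₁ ≈ b₁ * s → a₂ * t₂ ≈ b₂ * s → a₃ * t₃ ≈ b₃ * s →
    a₁ * a₂ * a₃ * (t₁ * t₂ * t₃) ≈ b₁ * b₂ * b₃ * (s * s * s)
  *-rescale {a₁} {a₂} {a₃} {b₁} {b₂} {b₃} {s} {t₁} {t₂} {t₃} p₁ p₂ p₃ = begin
    a₁ * a₂ * a₃ * (t₁ * t₂ * t₃)
      ≈⟨ shuffle a₁ a₂ a₃ t₁ t₂ t₃ ⟩
    a₁ * t₁ * (a₂ * t₂) * (a₃ * t₃)
      ≈⟨ *-cong (*-cong p₁ p₂) p₃ ⟩
    b₁ * s * (b₂ * s) * (b₃ * s)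
      ≈⟨ shuffle b₁ b₂ b₃ s s s ⟨
    b₁ * b₂ * b₃ * (s * s * s) ∎
    where
    shuffle : ∀ a b c x y z → a * b * c * (x * y * z) ≈ a * x * (b * y) * (c * z)
    shuffle = solve 6 (λ a b c x y z → a :* b :* c :* (x :* y :* z) := a :* x :* (b :* y) :* (c :* z)) refl

  [x-y]z≈xz-yz : ∀ x y z → (x - y) * z ≈ x * z - y * z
  [x-y]z≈xz-yz = solve 3 (λ x y z → (x :- y) :* z := x :* z :- y :* z) refl

  x*x*x#0 : ∀ {x} → x # 0# → x * x * x # 0#
  x*x*x#0 x#0 = x#0y#0→xy#0 (x#0y#0→xy#0 x#0 x#0) x#0

  module _ (r : Line) (x : Label → Point) (x∈r : ∀ a → x a ∈ r) where

    -- Since r × x_b is a multiple of r, a bracket [a b P] is proportional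
    -- to the value at P of the form defining r.
    bracket-change : ∀ a b P S → [ x a ∣ x b ∣ P ] * eval r S ≈ [ x a ∣ x b ∣ S ] * eval r P
    bracket-change a b P S =
      cramer-on (coeffs r) (coords (x a)) (coords (x b)) (coords P) (coords S) (x∈r a) (x∈r b)

    -- Each term of `QS` has exactly one bracket ending in each of `P¹`, `P²`, `P³`, so both terms
    -- are rescaled alike. Without division the identity also covers points `Pⁱ` on `r`.
    QS-change : ∀ ℓ S P¹ P² P³ →
      QS x ℓ S S S * (eval r P¹ * eval r P² * eval r P³) ≈
      QS x ℓ P¹ P² P³ * (eval r S * eval r S * eval r S)
    QS-change ℓ S P¹ P² P³ = begin
      (a₁ * a₂ * a₃ - b₁ * b₂ * b₃) * ρ
        ≈⟨ [x-y]z≈xz-yz (a₁ * a₂ * a₃) (b₁ * b₂ * b₃) ρ ⟩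
      a₁ * a₂ * a₃ * ρ - b₁ * b₂ * b₃ * ρ
        ≈⟨ +-cong (*-rescale (change p₁ m₁ P¹) (change p₂ m₂ P²) (change p₃ m₃ P³))
                  (-‿cong (*-rescale (change p₁ m₂ P¹) (change p₂ m₃ P²) (change p₃ m₁ P³))) ⟩
      a₁′ * a₂′ * a₃′ * σ - b₁′ * b₂′ * b₃′ * σ
        ≈⟨ [x-y]z≈xz-yz (a₁′ * a₂′ * a₃′) (b₁′ * b₂′ * b₃′) σ ⟨
      (a₁′ * a₂′ * a₃′ - b₁′ * b₂′ * b₃′) * σ ∎
      where
      change : ∀ a b P → [ x a ∣ x b ∣ S ] * eval r P ≈ [ x a ∣ x b ∣ P ] * eval r S
      change a b P = bracket-change a b S P
      p₁ p₂ p₃ m₁ m₂ m₃ : Label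
      p₁ = on ℓ 1st
      p₂ = on ℓ 2nd
      p₃ = on ℓ 3rd
      m₁ = off ℓ 1st
      m₂ = off ℓ 2nd
      m₃ = off ℓ 3rd
      ρ σ a₁ a₂ a₃ b₁ b₂ b₃ a₁′ a₂′ a₃′ b₁′ b₂′ b₃′ : Carrier
      ρ = eval r P¹ * eval r P² * eval r P³
      σ = eval r S * eval r S * eval r S
      a₁ = [ x p₁ ∣ x m₁ ∣ S ]
      a₂ = [ x p₂ ∣ x m₂ ∣ S ]
      a₃ = [ x p₃ ∣ x m₃ ∣ S ]
      b₁ = [ x p₁ ∣ x m₂ ∣ S ]
      b₂ = [ x p₂ ∣ x m₃ ∣ S ]
      b₃ = [ x p₃ ∣ x m₁ ∣ S ]
      a₁′ = [ x p₁ ∣ x m₁ ∣ P¹ ]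
      a₂′ = [ x p₂ ∣ x m₂ ∣ P² ]
      a₃′ = [ x p₃ ∣ x m₃ ∣ P³ ]
      b₁′ = [ x p₁ ∣ x m₂ ∣ P¹ ]
      b₂′ = [ x p₂ ∣ x m₃ ∣ P² ]
      b₃′ = [ x p₃ ∣ x m₁ ∣ P³ ]

    QS-vanishes : ∀ ℓ S → S ∉ r → QS x ℓ S S S ≈ 0# → ∀ P¹ P² P³ → QS x ℓ P¹ P² P³ ≈ 0#
    QS-vanishes ℓ S S∉r QS≈0 P¹ P² P³ = *-cancelˡ-0 (x*x*x#0 S∉r) (begin
      σ * QS x ℓ P¹ P² P³        ≈⟨ *-comm σ (QS x ℓ P¹ P² P³) ⟩
      QS x ℓ P¹ P² P³ * σ        ≈⟨ QS-change ℓ S P¹ P² P³ ⟨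
      QS x ℓ S S S * ρ           ≈⟨ *-congʳ QS≈0 ⟩
      0# * ρ                     ≈⟨ zeroˡ ρ ⟩
      0#                         ∎)
      where
      ρ σ : Carrier
      ρ = eval r P¹ * eval r P² * eval r P³
      σ = eval r S * eval r S * eval r S

  -- A frame point off a given line

  ·-scale : ∀ k u v → u · (λ i → k * v i) ≈ k * (u · v)
  ·-scale k u v = vector-identity (u ∷ v ∷ []) (k ∷ [])
    (λ { (u ∷ v ∷ []) (k ∷ []) → u :· (λ i → k :* v i) , k :* (u :· v) }) refl

  -- Minors of `w` of size one, two and three are shown to be apart from zero in turn, each stage
  -- feeding the minors of the previous one to `indep` as coefficients. With the full determinant
  -- apart from zero, Cramer's rule writes a nonzero coordinate of `r` through the values `r · w j`.
  independent⇒off : ∀ w → LinearlyIndependent w → ∀ r → Nonzero r → ∃[ j ] r · w j # 0#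
  independent⇒off w indep r (i , rᵢ#0) = off-line
    where
    w₁ w₂ w₃ : Vec³
    w₁ = w 1st
    w₂ = w 2nd
    w₃ = w 3rd
    w₁-nonzero : Nonzero w₁
    w₁-nonzero =
      let i , p = indep (e 1st) (1st , left-inverse⇒#0 1# (*-identityˡ 1#))
      in i , #-congʳ (e-· 1st (λ j → w j i)) p
    w₁w₂-independent : ∃[ t ] det w₁ w₂ t # 0#
    w₁w₂-independent =
      let i , w₁ᵢ#0 = w₁-nonzero
          a : Vec³
          -- These coefficients cancel coordinate `i`; at coordinate `k` they leave the minor of
          -- `w₁`, `w₂` in rows `i` and `k`.
          a = λ { 1st → - w₂ i ; 2nd → w₁ i ; 3rd → 0# }
          k , p = indep a (2nd , w₁ᵢ#0)
          minor : sum (λ j → a j * w j k) ≈ det w₁ w₂ (e i ⨯ e k)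
          minor = begin
            sum (λ j → a j * w j k)
              ≈⟨ solve 5 (λ p q r s t → (:- p) :* q :+ (r :* s :+ (con (+ 0) :* t :+ con (+ 0)))
                                        := r :* s :- q :* p) refl _ _ _ _ _ ⟩
            w₁ i * w₂ k - w₁ k * w₂ i
              ≈⟨ +-cong (*-cong (·-e w₁ i) (·-e w₂ k)) (-‿cong (*-cong (·-e w₁ k) (·-e w₂ i))) ⟨
            (w₁ · e i) * (w₂ · e k) - (w₁ · e k) * (w₂ · e i)
              ≈⟨ lagrange w₁ w₂ (e i) (e k) ⟨
            det w₁ w₂ (e i ⨯ e k) ∎
      in e i ⨯ e k , #-congʳ minor p
    det#0 : det w₁ w₂ w₃ # 0#
    det#0 =
      let t , d = w₁w₂-independent
          a : Vec³
          -- The Cramer coefficients of `t`: the combination is `t` times the full determinant.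
          a = λ { 1st → det t w₂ w₃ ; 2nd → det w₁ t w₃ ; 3rd → det w₁ w₂ t }
          i , p = indep a (3rd , d)
          expand : sum (λ j → a j * w j i) ≈ det w₁ w₂ w₃ * t i
          expand = begin
            sum (λ j → a j * w j i)
              ≈⟨ solve 3 (λ p q r → p :+ (q :+ (r :+ con (+ 0))) := p :+ q :+ r) refl _ _ _ ⟩
            det t w₂ w₃ * w₁ i + det w₁ t w₃ * w₂ i + det w₁ w₂ t * w₃ i
              ≈⟨ +-cong (+-cong (*-congˡ (e-· i w₁)) (*-congˡ (e-· i w₂))) (*-congˡ (e-· i w₃)) ⟨
            det t w₂ w₃ * (e i · w₁) + det w₁ t w₃ * (e i · w₂) + det w₁ w₂ t * (e i · w₃)
              ≈⟨ cramer (e i) w₁ w₂ w₃ t ⟨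
            det w₁ w₂ w₃ * (e i · t)
              ≈⟨ *-congˡ (e-· i t) ⟩
            det w₁ w₂ w₃ * t i ∎
      in x*y#0⇒x#0 (t i) (#-congʳ expand p)
    off-line : ∃[ j ] r · w j # 0#
    off-line =
      [ [ (λ p → 1st , x*y#0⇒y#0 d₁ p) , (λ p → 2nd , x*y#0⇒y#0 d₂ p) ]′ ∘ x+y#0⇒x#0⊎y#0 _ _
      , (λ p → 3rd , x*y#0⇒y#0 d₃ p) ]′ (x+y#0⇒x#0⊎y#0 _ _ terms#0)
      where
      d₁ d₂ d₃ : Carrier
      d₁ = det (e i) w₂ w₃
      d₂ = det w₁ (e i) w₃
      d₃ = det w₁ w₂ (e i)
      terms#0 : d₁ * (r · w₁) + d₂ * (r · w₂) + d₃ * (r · w₃) # 0#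
      terms#0 = #-congʳ (trans (*-congˡ (sym (·-e r i))) (cramer r w₁ w₂ w₃ (e i)))
                        (x#0y#0→xy#0 det#0 rᵢ#0)

  frame-off : ∀ {R U} → IsFrame R U → ∀ r → ∃[ j ] R j ∉ r
  frame-off {R} (w , w∼R , indep , _) r =
    let j , rw#0 = independent⇒off w indep (coeffs r) (Line.nonzero r)
        k , _ , w≈kR = w∼R j
    in j , x*y#0⇒y#0 k (#-congʳ (trans (·-congˡ (coeffs r) w≈kR) (·-scale k (coeffs r) (coords (R j)))) rw#0)

  -- Projection from a point, and why projected points make `QS` vanish

  -- Any ν p + μ P with r-value zero is a multiple of this vector, so up to
  -- scale it is the image of p under projection from P to the line r.
  project : (r P p : Vec³) → Vec³
  project r P p i = r · P * p i - r · p * P i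

  -- With `t` completing `p`, `P` to a basis, Cramer's rule gives `d x = α p + β P`, the `t` term
  -- being killed by collinearity. That `x` lies on `r` then ties `β` to `α`.
  projection-unique : ∀ r P p x l → r · P # 0# → Nonzero P → Nonzero p → p ≁ P → Nonzero l →
    l · P ≈ 0# → l · p ≈ 0# → l · x ≈ 0# → r · x ≈ 0# → ∃[ k ] ∀ i → x i ≈ k * project r P p i
  projection-unique r P p x l ρ#0 P-nz p-nz p≁P l-nz lP lp lx rx =
    let t , d#0 = ≁⇒det#0 p P p-nz P-nz p≁P
        d = det p P t
        α = det x P t
        β = det p x t
        z , zdρ≈1 = left-inverse (x#0y#0→xy#0 d#0 ρ#0)
        -- Kept for all covectors `v`: at `r` it relates `α` and `β`, at `e i` it yields the
        -- coordinates of `x`.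
        expand : ∀ v → d * (v · x) ≈ α * (v · p) + β * (v · P)
        expand v = begin
          d * (v · x)
            ≈⟨ cramer v p P t x ⟩
          α * (v · p) + β * (v · P) + det p P x * (v · t)
            ≈⟨ +-congˡ (*-congʳ (collinear⇒det≈0 l p P x l-nz lp lP lx)) ⟩
          α * (v · p) + β * (v · P) + 0# * (v · t)
            ≈⟨ solve 2 (λ s y → s :+ con (+ 0) :* y := s) refl _ (v · t) ⟩
          α * (v · p) + β * (v · P) ∎
        βρ≈-αrp : β * (r · P) ≈ - (α * (r · p))
        βρ≈-αrp = begin
          β * (r · P)
            ≈⟨ solve 2 (λ a b → b := (a :+ b) :- a) refl (α * (r · p)) (β * (r · P)) ⟩
          α * (r · p) + β * (r · P) - α * (r · p)   ≈⟨ +-congʳ (expand r) ⟨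
          d * (r · x) - α * (r · p)                 ≈⟨ +-congʳ (*-congˡ rx) ⟩
          d * 0# - α * (r · p)                      ≈⟨ +-congʳ (zeroʳ d) ⟩
          0# - α * (r · p)                          ≈⟨ +-identityˡ _ ⟩
          - (α * (r · p))                           ∎
    in z * α , λ i → begin
      x i                                              ≈⟨ *-identityˡ (x i) ⟨
      1# * x i                                         ≈⟨ *-congʳ zdρ≈1 ⟨
      z * (d * (r · P)) * x i
        ≈⟨ solve 4 (λ z d ρ x → z :* (d :* ρ) :* x := z :* ((d :* x) :* ρ)) refl z d (r · P) (x i) ⟩
      z * (d * x i * (r · P))
        ≈⟨ *-congˡ (*-congʳ (*-congˡ (e-· i x))) ⟨
      z * (d * (e i · x) * (r · P))
        ≈⟨ *-congˡ (*-congʳ (expand (e i))) ⟩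
      z * ((α * (e i · p) + β * (e i · P)) * (r · P))
        ≈⟨ *-congˡ (*-congʳ (+-cong (*-congˡ (e-· i p)) (*-congˡ (e-· i P)))) ⟩
      z * ((α * p i + β * P i) * (r · P))
        ≈⟨ solve 6 (λ z α p β P ρ → z :* ((α :* p :+ β :* P) :* ρ) := z :* (α :* (ρ :* p) :+ β :* ρ :* P))
             refl z α (p i) β (P i) (r · P) ⟩
      z * (α * (r · P * p i) + β * (r · P) * P i)
        ≈⟨ *-congˡ (+-congˡ (*-congʳ βρ≈-αrp)) ⟩
      z * (α * (r · P * p i) + - (α * (r · p)) * P i)
        ≈⟨ solve 5 (λ z α m s P → z :* (α :* m :+ (:- (α :* s)) :* P) := z :* α :* (m :- s :* P))
             refl z α (r · P * p i) (r · p) (P i) ⟩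
      z * α * (r · P * p i - r · p * P i)              ∎

  -- By duality `q` acts as a line through the points `a`, `b`, so `cramer-on` compares `det a b t`
  -- with the coordinates of `a ⨯ b`.
  intersection : ∀ a b q → Nonzero a → Nonzero b → a ≁ b → a · q ≈ 0# → b · q ≈ 0# →
    ∃[ k ] ∀ i → q i ≈ k * (a ⨯ b) i
  intersection a b q a-nz b-nz a≁b aq bq =
    let t , d#0 = ≁⇒det#0 a b a-nz b-nz a≁b
        d = det a b t
        z , zd≈1 = left-inverse d#0
    in z * (q · t) , λ i → begin
      q i                                   ≈⟨ *-identityˡ (q i) ⟨
      1# * q i                              ≈⟨ *-congʳ zd≈1 ⟨
      z * d * q i                           ≈⟨ *-assoc z d (q i) ⟩
      z * (d * q i)                         ≈⟨ *-congˡ (*-congˡ (·-e q i)) ⟨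
      z * (d * (q · e i))
        ≈⟨ *-congˡ (cramer-on q a b t (e i) (trans (·-comm q a) aq) (trans (·-comm q b) bq)) ⟩
      z * (det a b (e i) * (q · t))         ≈⟨ *-congˡ (*-congʳ (⨯-· a b (e i))) ⟨
      z * ((a ⨯ b) · e i * (q · t))         ≈⟨ *-congˡ (*-congʳ (·-e (a ⨯ b) i)) ⟩
      z * ((a ⨯ b) i * (q · t))
        ≈⟨ solve 3 (λ z n s → z :* (n :* s) := z :* s :* n) refl z ((a ⨯ b) i) (q · t) ⟩
      z * (q · t) * (a ⨯ b) i               ∎

  -- The vector `a ⨯ b` is the intersection of the lines `a` and `b`. The factor `k` is kept
  -- explicit because it is carried through the products of brackets.
  Shadow : (r P a b x : Vec³) → Set _
  Shadow r P a b x = ∃[ k ] ∀ i → x i ≈ k * project r P (a ⨯ b) i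

  -- The cross product changes sign. This brings the line shared by two points to the front, as
  -- `shadow-bracket` expects.
  shadow-swap : ∀ r P a b x → Shadow r P a b x → Shadow r P b a x
  shadow-swap r P a b x (k , x≈) = - k , λ i → trans (x≈ i) (antisym i)
    where
    expr : ∀ {n} → Fin 3 → Vec (Vector (Polynomial n) 3) 4 → Vec (Polynomial n) 1 → Polynomial n × Polynomial n
    expr i (r ∷ P ∷ a ∷ b ∷ []) (k ∷ []) =
      k :* (r :· P :* (a :⨯ b) i :- r :· (a :⨯ b) :* P i) ,
      (:- k) :* (r :· P :* (b :⨯ a) i :- r :· (b :⨯ a) :* P i)
    antisym : ∀ i → k * project r P (a ⨯ b) i ≈ - k * project r P (b ⨯ a) i
    antisym 1st = vector-identity (r ∷ P ∷ a ∷ b ∷ []) (k ∷ []) (expr 1st) refl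
    antisym 2nd = vector-identity (r ∷ P ∷ a ∷ b ∷ []) (k ∷ []) (expr 2nd) refl
    antisym 3rd = vector-identity (r ∷ P ∷ a ∷ b ∷ []) (k ∷ []) (expr 3rd) refl

  project-scale : ∀ r P k p q → (∀ i → q i ≈ k * p i) → ∀ i → project r P q i ≈ k * project r P p i
  project-scale r P k p q q≈kp i = begin
    r · P * q i - r · q * P i
      ≈⟨ +-cong (*-congˡ (q≈kp i)) (-‿cong (*-congʳ (trans (·-congˡ r q≈kp) (·-scale k r p)))) ⟩
    r · P * (k * p i) - k * (r · p) * P i
      ≈⟨ solve 5 (λ ρ k p s P → ρ :* (k :* p) :- k :* s :* P := k :* (ρ :* p :- s :* P)) refl
           (r · P) k (p i) (r · p) (P i) ⟩
    k * project r P p i ∎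

  -- The multiples of `P` in the first two columns drop out against the third.
  det-projected : ∀ k l ρ s t u v P →
    det (λ i → k * (ρ * u i - s * P i)) (λ i → l * (ρ * v i - t * P i)) P ≈ k * l * (ρ * ρ) * det u v P
  det-projected k l ρ s t u v P = vector-identity (u ∷ v ∷ P ∷ []) (k ∷ l ∷ ρ ∷ s ∷ t ∷ [])
    (λ { (u ∷ v ∷ P ∷ []) (k ∷ l ∷ ρ ∷ s ∷ t ∷ []) →
      :det (λ i → k :* (ρ :* u i :- s :* P i)) (λ i → l :* (ρ :* v i :- t :* P i)) P ,
      k :* l :* (ρ :* ρ) :* :det u v P }) refl

  shadow-bracket : ∀ r P a b c x y ((k , _) : Shadow r P a b x) ((l , _) : Shadow r P a c y) →
    det x y P ≈ k * l * (r · P * (r · P)) * (det a b c * (a · P))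
  shadow-bracket r P a b c x y (k , x≈) (l , y≈) = begin
    det x y P
      ≈⟨ det-cong₁₂ P x≈ y≈ ⟩
    det (λ i → k * project r P (a ⨯ b) i) (λ i → l * project r P (a ⨯ c) i) P
      ≈⟨ det-projected k l (r · P) (r · (a ⨯ b)) (r · (a ⨯ c)) (a ⨯ b) (a ⨯ c) P ⟩
    k * l * (r · P * (r · P)) * det (a ⨯ b) (a ⨯ c) P
      ≈⟨ *-congˡ (det-⨯⨯ a b c P) ⟩
    k * l * (r · P * (r · P)) * (det a b c * (a · P)) ∎

  -- Writing each point as the shadow of the intersection of two of the four
  -- lines turns both terms of QS into the same product.
  shadows⇒QS : ∀ r P l a b c p₁ p₂ p₃ m₁ m₂ m₃ →
    Shadow r P a l p₁ → Shadow r P b l p₂ → Shadow r P c l p₃ →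
    Shadow r P a c m₁ → Shadow r P a b m₂ → Shadow r P b c m₃ →
    det p₁ m₁ P * det p₂ m₂ P * det p₃ m₃ P - det p₁ m₂ P * det p₂ m₃ P * det p₃ m₁ P ≈ 0#
  shadows⇒QS r P l a b c p₁ p₂ p₃ m₁ m₂ m₃ s₁@(k₁ , _) s₂@(k₂ , _) s₃@(k₃ , _)
             t₁@(n₁ , _) t₂@(n₂ , _) t₃@(n₃ , _) = begin
    det p₁ m₁ P * det p₂ m₂ P * det p₃ m₃ P - det p₁ m₂ P * det p₂ m₃ P * det p₃ m₁ P
      ≈⟨ +-cong (*-cong (*-cong [p₁m₁] [p₂m₂]) [p₃m₃]) (-‿cong (*-cong (*-cong [p₁m₂] [p₂m₃]) [p₃m₁])) ⟩
    k₁ * n₁ * ρ² * (α * A) * (k₂ * - n₂ * ρ² * (β * B)) * (k₃ * - n₃ * ρ² * (γ * C)) -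
    k₁ * n₂ * ρ² * (- β * A) * (k₂ * n₃ * ρ² * (- γ * B)) * (k₃ * - n₁ * ρ² * (- α * C))
      -- The swaps contribute two signs to the first product and four to the second, so both signs
      -- cancel.
      ≈⟨ solve 13 (λ k₁ k₂ k₃ n₁ n₂ n₃ ρ² α β γ A B C →
           k₁ :* n₁ :* ρ² :* (α :* A) :* (k₂ :* (:- n₂) :* ρ² :* (β :* B)) :* (k₃ :* (:- n₃) :* ρ² :* (γ :* C)) :-
           k₁ :* n₂ :* ρ² :* ((:- β) :* A) :* (k₂ :* n₃ :* ρ² :* ((:- γ) :* B)) :* (k₃ :* (:- n₁) :* ρ² :* ((:- α) :* C))
           := con (+ 0)) refl k₁ k₂ k₃ n₁ n₂ n₃ ρ² α β γ A B C ⟩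
    0# ∎
    where
    ρ² α β γ A B C : Carrier
    ρ² = r · P * (r · P)
    α = det a l c
    β = det b l a
    γ = det c l b
    A = a · P
    B = b · P
    C = c · P
    [p₁m₁] : det p₁ m₁ P ≈ k₁ * n₁ * ρ² * (α * A)
    [p₁m₁] = shadow-bracket r P a l c p₁ m₁ s₁ t₁
    [p₂m₂] : det p₂ m₂ P ≈ k₂ * - n₂ * ρ² * (β * B)
    [p₂m₂] = shadow-bracket r P b l a p₂ m₂ s₂ (shadow-swap r P a b m₂ t₂)
    [p₃m₃] : det p₃ m₃ P ≈ k₃ * - n₃ * ρ² * (γ * C)
    [p₃m₃] = shadow-bracket r P c l b p₃ m₃ s₃ (shadow-swap r P b c m₃ t₃)
    [p₁m₂] : det p₁ m₂ P ≈ k₁ * n₂ * ρ² * (- β * A)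
    [p₁m₂] = trans (shadow-bracket r P a l b p₁ m₂ s₁ t₂) (*-congˡ (*-congʳ (det-swap-outer a l b)))
    [p₂m₃] : det p₂ m₃ P ≈ k₂ * n₃ * ρ² * (- γ * B)
    [p₂m₃] = trans (shadow-bracket r P b l c p₂ m₃ s₂ t₃) (*-congˡ (*-congʳ (det-swap-outer b l c)))
    [p₃m₁] : det p₃ m₁ P ≈ k₃ * - n₁ * ρ² * (- α * C)
    [p₃m₁] = trans (shadow-bracket r P c l a p₃ m₁ s₃ (shadow-swap r P a c m₁ t₁))
                   (*-congˡ (*-congʳ (det-swap-outer c l a)))

  projected⇒QS : ∀ r x → IsProjectedQuadrilateralSet r x →
    ∃[ P ] P ∉ r × (∀ ℓ → QS x ℓ P P P ≈ 0#)
  projected⇒QS r x (P , P∉r , Q , projects) = P , P∉r , vanishes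
    where
    open QuadrilateralSet Q
    shadow : ∀ a m n → m ≢ n → a ∈ᶜ m → a ∈ᶜ n →
             Shadow (coeffs r) (coords P) (coeffs (line m)) (coeffs (line n)) (coords (x a))
    shadow a m n m≢n (i , i≡a) (j , j≡a) =
      let q = point a
          q∈m = ≡.subst (λ a → point a ∈ line m) i≡a (incident m i)
          q∈n = ≡.subst (λ a → point a ∈ line n) j≡a (incident n j)
          q≠P , (l , P∈l , q∈l , x∈l) , x∈r = projects a
          k , q≈ = intersection (coeffs (line m)) (coeffs (line n)) (coords q)
                     (Line.nonzero (line m)) (Line.nonzero (line n)) (lines-distinct m n m≢n) q∈m q∈n
          k′ , x≈ = projection-unique (coeffs r) (coords P) (coords q) (coords (x a)) (coeffs l)
                      P∉r (Point.nonzero P) (Point.nonzero q) q≠P (Line.nonzero l) P∈l q∈l x∈l x∈r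
          scale = project-scale (coeffs r) (coords P) k (coeffs (line m) ⨯ coeffs (line n)) (coords q) q≈
      -- The point `q` is `k` times the intersection of the two lines, and `x a` is `k′` times the
      -- projection of `q`.
      in k′ * k , λ i → trans (x≈ i) (trans (*-congˡ (scale i)) (sym (*-assoc k′ k _)))
    vanishes : ∀ ℓ → QS x ℓ P P P ≈ 0#
    vanishes ℓ with off-spec ℓ
    -- The points on `ℓ` are its intersections with `a`, `b`, `c`; the points off `ℓ` are the
    -- intersections of `a` with `c`, `a` with `b`, and `b` with `c`, in this order.
    ... | a , b , c , (ℓ≢a , ℓ≢b , ℓ≢c , a≢b , a≢c , b≢c)
        , (p₁∈a , m₁∈a , m₂∈a) , (p₂∈b , m₂∈b , m₃∈b) , (p₃∈c , m₁∈c , m₃∈c) =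
      shadows⇒QS (coeffs r) (coords P) (coeffs (line ℓ)) (coeffs (line a)) (coeffs (line b)) (coeffs (line c))
        (coords (x (on ℓ 1st))) (coords (x (on ℓ 2nd))) (coords (x (on ℓ 3rd)))
        (coords (x (off ℓ 1st))) (coords (x (off ℓ 2nd))) (coords (x (off ℓ 3rd)))
        (shadow _ a ℓ (ℓ≢a ∘ ≡.sym) p₁∈a (1st , ≡.refl))
        (shadow _ b ℓ (ℓ≢b ∘ ≡.sym) p₂∈b (2nd , ≡.refl))
        (shadow _ c ℓ (ℓ≢c ∘ ≡.sym) p₃∈c (3rd , ≡.refl))
        (shadow _ a c a≢c m₁∈a m₁∈c) (shadow _ a b a≢b m₂∈a m₂∈b) (shadow _ b c b≢c m₃∈b m₃∈c)

  -- Lifting points of `r` to a quadrilateral set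

  ≁⇒bracket#0 : ∀ r a b w → r · a ≈ 0# → r · b ≈ 0# → Nonzero a → Nonzero b → a ≁ b →
    r · w # 0# → det a b w # 0#
  ≁⇒bracket#0 r a b w ra rb a-nz b-nz a≁b rw#0 = bracket#0 (≁⇒det#0 a b a-nz b-nz a≁b)
    where
    bracket#0 : ∃[ t ] det a b t # 0# → det a b w # 0#
    bracket#0 (t , d#0) = x*y#0⇒x#0 {det a b w} (r · t) product#0
      where
      product#0 : det a b w * (r · t) # 0#
      -- The unspecified `t` that separates `a` from `b` is exchanged for `w`, which is off `r`.
      product#0 = #-congʳ {det a b t * (r · w)} (cramer-on r a b t w ra rb) (x#0y#0→xy#0 d#0 rw#0)

  module Lift (r : Line) (x : Label → Point) (x∈r : ∀ a → x a ∈ r)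
              (x-distinct : ∀ a b → a ≢ b → x a ≠ x b)
              (W : Point) (W∉r : W ∉ r) (QS≈0 : QS x ℓ₁₂₃ W W W ≈ 0#) where

    private
      R w : Vec³
      R = coeffs r
      w = coords W

    v : Label → Vec³
    v a = coords (x a)

    -- The bracket of the projective line `r`, realised by fixing the centre as third column.
    ⟨_,_⟩ : Label → Label → Carrier
    ⟨ a , b ⟩ = det (v a) (v b) w

    ⟨⟩#0 : ∀ a b → a ≢ b → ⟨ a , b ⟩ # 0#
    ⟨⟩#0 a b a≢b =
      ≁⇒bracket#0 R (v a) (v b) w (x∈r a) (x∈r b)
        (Point.nonzero (x a)) (Point.nonzero (x b)) (x-distinct a b a≢b) W∉r

    -- The line ℓ₁₂₃ is lifted to r itself; each other line passes through one
    -- of the fixed points ①, ②, ③, and the slopes are chosen so that the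
    -- three lifted lines meet pairwise above ④, ⑤ and ⑥. The last of these
    -- conditions, above ④, is QS = 0.
    base : CombLine → Label
    base ℓ₁₂₃ = ①
    base ℓ₁₅₆ = ①
    base ℓ₂₄₆ = ②
    base ℓ₃₄₅ = ③

    slope : CombLine → Carrier
    slope ℓ₁₂₃ = 0#
    slope ℓ₁₅₆ = ⟨ ② , ⑥ ⟩ * ⟨ ③ , ⑤ ⟩
    slope ℓ₂₄₆ = ⟨ ① , ⑥ ⟩ * ⟨ ③ , ⑤ ⟩
    slope ℓ₃₄₅ = ⟨ ② , ⑥ ⟩ * ⟨ ① , ⑤ ⟩

    -- The multiple of `w` added to a point. The lift of `ℓ` is to have height `slope ℓ` times the
    -- bracket with its base point; `④`, `⑤`, `⑥` each lie on two such lines, and one of the two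
    -- values is taken.
    height : Label → Carrier
    height ① = 0#
    height ② = 0#
    height ③ = 0#
    height ④ = slope ℓ₂₄₆ * ⟨ ② , ④ ⟩
    height ⑤ = slope ℓ₁₅₆ * ⟨ ① , ⑤ ⟩
    height ⑥ = slope ℓ₁₅₆ * ⟨ ① , ⑥ ⟩

    xy∙z≈xz∙y : ∀ p q s → p * q * s ≈ p * s * q
    xy∙z≈xz∙y = solve 3 (λ p q s → p :* q :* s := p :* s :* q) refl

    level : ∀ k a → 0# ≈ k * ⟨ a , a ⟩
    level k a = begin
      0#             ≈⟨ zeroʳ k ⟨
      k * 0#         ≈⟨ *-congˡ {k} (det-repeated (v a) w) ⟨
      k * ⟨ a , a ⟩  ∎

    meet₄ : slope ℓ₂₄₆ * ⟨ ② , ④ ⟩ ≈ slope ℓ₃₄₅ * ⟨ ③ , ④ ⟩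
    meet₄ = meet ⟨ ① , ⑤ ⟩ ⟨ ② , ⑥ ⟩ ⟨ ③ , ④ ⟩ ⟨ ① , ⑥ ⟩ ⟨ ② , ④ ⟩ ⟨ ③ , ⑤ ⟩ QS≈0
      where
      meet : ∀ a b c d f g → a * b * c - d * f * g ≈ 0# → d * g * f ≈ b * a * c
      meet a b c d f g abc-dfg≈0 = begin
        d * g * f   ≈⟨ xy∙z≈xz∙y d g f ⟩
        d * f * g   ≈⟨ x∙y⁻¹≈ε⇒x≈y (a * b * c) (d * f * g) abc-dfg≈0 ⟨
        a * b * c   ≈⟨ *-congʳ (*-comm a b) ⟩
        b * a * c   ∎

    meet₅ : slope ℓ₁₅₆ * ⟨ ① , ⑤ ⟩ ≈ slope ℓ₃₄₅ * ⟨ ③ , ⑤ ⟩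
    meet₅ = xy∙z≈xz∙y ⟨ ② , ⑥ ⟩ ⟨ ③ , ⑤ ⟩ ⟨ ① , ⑤ ⟩

    meet₆ : slope ℓ₁₅₆ * ⟨ ① , ⑥ ⟩ ≈ slope ℓ₂₄₆ * ⟨ ② , ⑥ ⟩
    meet₆ = solve 3 (λ p q s → p :* q :* s := s :* q :* p) refl ⟨ ② , ⑥ ⟩ ⟨ ③ , ⑤ ⟩ ⟨ ① , ⑥ ⟩

    height-on : ∀ ℓ i → height (on ℓ i) ≈ slope ℓ * ⟨ base ℓ , on ℓ i ⟩
    height-on ℓ₁₂₃ 1st = sym (zeroˡ ⟨ ① , ① ⟩)
    height-on ℓ₁₂₃ 2nd = sym (zeroˡ ⟨ ① , ② ⟩)
    height-on ℓ₁₂₃ 3rd = sym (zeroˡ ⟨ ① , ③ ⟩)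
    height-on ℓ₁₅₆ 1st = level (slope ℓ₁₅₆) ①
    height-on ℓ₁₅₆ 2nd = refl
    height-on ℓ₁₅₆ 3rd = refl
    height-on ℓ₂₄₆ 1st = level (slope ℓ₂₄₆) ②
    height-on ℓ₂₄₆ 2nd = refl
    height-on ℓ₂₄₆ 3rd = meet₆
    height-on ℓ₃₄₅ 1st = level (slope ℓ₃₄₅) ③
    height-on ℓ₃₄₅ 2nd = meet₄
    height-on ℓ₃₄₅ 3rd = meet₅

    slope₁₅₆#0 : slope ℓ₁₅₆ # 0#
    slope₁₅₆#0 = x#0y#0→xy#0 (⟨⟩#0 ② ⑥ λ ()) (⟨⟩#0 ③ ⑤ λ ())

    slope₂₄₆#0 : slope ℓ₂₄₆ # 0#
    slope₂₄₆#0 = x#0y#0→xy#0 (⟨⟩#0 ① ⑥ λ ()) (⟨⟩#0 ③ ⑤ λ ())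

    slope₃₄₅#0 : slope ℓ₃₄₅ # 0#
    slope₃₄₅#0 = x#0y#0→xy#0 (⟨⟩#0 ② ⑥ λ ()) (⟨⟩#0 ① ⑤ λ ())

    below : ∀ {s t} → s # 0# → t # 0# → 0# # s * t
    below s#0 t#0 = #-sym (x#0y#0→xy#0 s#0 t#0)

    above : ∀ {s t u} → s # 0# → t # 0# → s * t # 0# * u
    above s#0 t#0 = #-congˡ (sym (zeroˡ _)) (x#0y#0→xy#0 s#0 t#0)

    -- Used to tell the lifted lines apart. A fixed point at height zero serves where `m` has
    -- nonzero slope, and a raised point where `m` is `ℓ₁₂₃`.
    point-off : ∀ ℓ m → ℓ ≢ m → ∃[ i ] height (on ℓ i) # slope m * ⟨ base m , on ℓ i ⟩
    point-off ℓ₁₂₃ ℓ₁₂₃ ℓ≢ℓ = contradiction ≡.refl ℓ≢ℓ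
    point-off ℓ₁₂₃ ℓ₁₅₆ _ = 2nd , below slope₁₅₆#0 (⟨⟩#0 ① ② λ ())
    point-off ℓ₁₂₃ ℓ₂₄₆ _ = 1st , below slope₂₄₆#0 (⟨⟩#0 ② ① λ ())
    point-off ℓ₁₂₃ ℓ₃₄₅ _ = 1st , below slope₃₄₅#0 (⟨⟩#0 ③ ① λ ())
    point-off ℓ₁₅₆ ℓ₁₂₃ _ = 2nd , above slope₁₅₆#0 (⟨⟩#0 ① ⑤ λ ())
    point-off ℓ₁₅₆ ℓ₁₅₆ ℓ≢ℓ = contradiction ≡.refl ℓ≢ℓ
    point-off ℓ₁₅₆ ℓ₂₄₆ _ = 1st , below slope₂₄₆#0 (⟨⟩#0 ② ① λ ())
    point-off ℓ₁₅₆ ℓ₃₄₅ _ = 1st , below slope₃₄₅#0 (⟨⟩#0 ③ ① λ ())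
    point-off ℓ₂₄₆ ℓ₁₂₃ _ = 2nd , above slope₂₄₆#0 (⟨⟩#0 ② ④ λ ())
    point-off ℓ₂₄₆ ℓ₁₅₆ _ = 1st , below slope₁₅₆#0 (⟨⟩#0 ① ② λ ())
    point-off ℓ₂₄₆ ℓ₂₄₆ ℓ≢ℓ = contradiction ≡.refl ℓ≢ℓ
    point-off ℓ₂₄₆ ℓ₃₄₅ _ = 1st , below slope₃₄₅#0 (⟨⟩#0 ③ ② λ ())
    -- The height of `④` is defined through `ℓ₂₄₆`, hence its slope here.
    point-off ℓ₃₄₅ ℓ₁₂₃ _ = 2nd , above slope₂₄₆#0 (⟨⟩#0 ② ④ λ ())
    point-off ℓ₃₄₅ ℓ₁₅₆ _ = 1st , below slope₁₅₆#0 (⟨⟩#0 ① ③ λ ())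
    point-off ℓ₃₄₅ ℓ₂₄₆ _ = 1st , below slope₂₄₆#0 (⟨⟩#0 ② ③ λ ())
    point-off ℓ₃₄₅ ℓ₃₄₅ ℓ≢ℓ = contradiction ≡.refl ℓ≢ℓ

    lifted : Label → Vec³
    lifted a i = v a i + height a * w i

    -- At a lifted point `R` takes the value `R · w` times the height, and `w ⨯ v (base ℓ)` the
    -- bracket with the base point; the form therefore compares actual with prescribed height.
    covector : CombLine → Vec³
    covector ℓ i = R i - R · w * slope ℓ * (w ⨯ v (base ℓ)) i

    covector-lifted : ∀ ℓ a → covector ℓ · lifted a ≈ R · w * (height a - slope ℓ * ⟨ base ℓ , a ⟩)
    covector-lifted ℓ a = begin
      covector ℓ · lifted a
        ≈⟨ vector-identity (R ∷ w ∷ v (base ℓ) ∷ v a ∷ []) (slope ℓ ∷ height a ∷ [])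
             (λ { (R ∷ w ∷ y ∷ v ∷ []) (k ∷ h ∷ []) →
               (λ i → R i :- R :· w :* k :* (w :⨯ y) i) :· (λ i → v i :+ h :* w i) ,
               R :· v :+ R :· w :* (h :- k :* :det y v w) }) refl ⟩
      R · v a + R · w * (height a - slope ℓ * ⟨ base ℓ , a ⟩)   ≈⟨ +-congʳ (x∈r a) ⟩
      0# + R · w * (height a - slope ℓ * ⟨ base ℓ , a ⟩)        ≈⟨ +-identityˡ _ ⟩
      R · w * (height a - slope ℓ * ⟨ base ℓ , a ⟩)             ∎

    -- The correction term is a cross product with `w` and vanishes at `w`; the centre is thus off
    -- every lifted line.
    covector-centre : ∀ ℓ → covector ℓ · w ≈ R · w
    covector-centre ℓ = vector-identity (R ∷ w ∷ v (base ℓ) ∷ []) (slope ℓ ∷ [])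
      (λ { (R ∷ w ∷ y ∷ []) (k ∷ []) → (λ i → R i :- R :· w :* k :* (w :⨯ y) i) :· w , R :· w }) refl

    lifted-on : ∀ ℓ i → covector ℓ · lifted (on ℓ i) ≈ 0#
    lifted-on ℓ i = begin
      covector ℓ · lifted (on ℓ i)
        ≈⟨ covector-lifted ℓ (on ℓ i) ⟩
      R · w * (height (on ℓ i) - slope ℓ * ⟨ base ℓ , on ℓ i ⟩)
        ≈⟨ *-congˡ (+-congʳ (height-on ℓ i)) ⟩
      R · w * (slope ℓ * ⟨ base ℓ , on ℓ i ⟩ - slope ℓ * ⟨ base ℓ , on ℓ i ⟩)
        ≈⟨ solve 2 (λ ρ s → ρ :* (s :- s) := con (+ 0)) refl (R · w) (slope ℓ * ⟨ base ℓ , on ℓ i ⟩) ⟩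
      0# ∎

    -- Evaluation at a point of `ℓ` off `m` kills the first form but not `k` times the second.
    covectors-distinct : ∀ ℓ m → ℓ ≢ m → covector ℓ ≁ covector m
    covectors-distinct ℓ m ℓ≢m k k#0 =
      let i , h#s = point-off ℓ m ℓ≢m
          p = lifted (on ℓ i)
          difference : (λ j → covector ℓ j - k * covector m j) · p ≈ - (k * (covector m · p))
          difference = begin
            (λ j → covector ℓ j - k * covector m j) · p
              ≈⟨ vector-identity (covector ℓ ∷ covector m ∷ p ∷ []) (k ∷ [])
                   (λ { (l ∷ m ∷ p ∷ []) (k ∷ []) → (λ j → l j :- k :* m j) :· p ,
                          l :· p :- k :* (m :· p) }) refl ⟩
            covector ℓ · p - k * (covector m · p)   ≈⟨ +-congʳ (lifted-on ℓ i) ⟩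
            0# - k * (covector m · p)               ≈⟨ +-identityˡ _ ⟩
            - (k * (covector m · p))                ∎
          off#0 = #-congʳ (sym (covector-lifted m (on ℓ i))) (x#0y#0→xy#0 W∉r (x#y⇒x-y#0 h#s))
          j , d#0 = ·#0⇒Nonzeroˡ (λ j → covector ℓ j - k * covector m j) p
                      (#-congʳ (sym difference) (-x#0 (x#0y#0→xy#0 k#0 off#0)))
      in j , x-y#0⇒x#y d#0

    -- Lifting moves points along lines through the centre, which brackets ending in `w` do not see.
    -- Distinctness of the lifted points is inherited from `r` in this way.
    det-lifted : ∀ a b → det (lifted a) (lifted b) w ≈ ⟨ a , b ⟩
    det-lifted a b = vector-identity (v a ∷ v b ∷ w ∷ []) (height a ∷ height b ∷ [])
      (λ { (u ∷ v ∷ w ∷ []) (h ∷ k ∷ []) →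
        :det (λ i → u i :+ h :* w i) (λ i → v i :+ k :* w i) w , :det u v w }) refl

    det-lifted#0 : ∀ a b → a ≢ b → det (lifted a) (lifted b) w # 0#
    det-lifted#0 a b a≢b = #-congʳ {⟨ a , b ⟩} (sym (det-lifted a b)) (⟨⟩#0 a b a≢b)

    other : (a : Label) → ∃[ b ] a ≢ b
    other ① = ② , λ ()
    other ② = ① , λ ()
    other ③ = ① , λ ()
    other ④ = ① , λ ()
    other ⑤ = ① , λ ()
    other ⑥ = ① , λ ()

    lifted-nonzero : ∀ a → Nonzero (lifted a)
    lifted-nonzero a =
      let b , a≢b = other a in det#0⇒Nonzero (lifted a) (lifted b) w (det-lifted#0 a b a≢b)

    lifted≁w : ∀ a → lifted a ≁ w
    lifted≁w a = det#0⇒≁ (lifted a) w (lifted b) d#0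
      where
      b : Label
      b = proj₁ (other a)
      d#0 : det (lifted a) w (lifted b) # 0#
      d#0 = #-congʳ {det (lifted b) (lifted a) w} (det-cycle (lifted b) (lifted a) w)
              (det-lifted#0 b a (proj₂ (other a) ∘ ≡.sym))

    covector-nonzero : ∀ ℓ → Nonzero (covector ℓ)
    covector-nonzero ℓ =
      ·#0⇒Nonzeroˡ (covector ℓ) w (#-congʳ {R · w} (sym (covector-centre ℓ)) W∉r)

    quadrilateral : QuadrilateralSet
    quadrilateral = record
      { line            = λ ℓ → mkLine (covector ℓ) (covector-nonzero ℓ)
      ; point           = λ a → mkPoint (lifted a) (lifted-nonzero a)
      ; incident        = lifted-on
      ; lines-distinct  = covectors-distinct
      ; points-distinct = λ a b a≢b → det#0⇒≁ (lifted a) (lifted b) w (det-lifted#0 a b a≢b)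
      }

    ray : Label → Line
    ray a = mkLine (w ⨯ v a) (·#0⇒Nonzeroˡ (w ⨯ v a) (v b) ray#0)
      where
      b : Label
      b = proj₁ (other a)
      ray#0 : (w ⨯ v a) · v b # 0#
      ray#0 = #-congʳ {⟨ a , b ⟩} (sym (trans (⨯-· w (v a) (v b)) (det-cycle w (v a) (v b))))
                (⟨⟩#0 a b (proj₂ (other a)))

    projected : IsProjectedQuadrilateralSet r x
    projected = W , W∉r , quadrilateral , λ a →
      lifted≁w a , (ray a , ray-W a , ray-lifted a , ray-x a) , x∈r a
      where
      ray-W : ∀ a → (w ⨯ v a) · w ≈ 0#
      ray-W a = vector-identity (w ∷ v a ∷ []) []
        (λ { (w ∷ v ∷ []) _ → (w :⨯ v) :· w , con (+ 0) }) refl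
      ray-x : ∀ a → (w ⨯ v a) · v a ≈ 0#
      ray-x a = vector-identity (w ∷ v a ∷ []) []
        (λ { (w ∷ v ∷ []) _ → (w :⨯ v) :· v , con (+ 0) }) refl
      ray-lifted : ∀ a → (w ⨯ v a) · lifted a ≈ 0#
      ray-lifted a = vector-identity (w ∷ v a ∷ []) (height a ∷ [])
        (λ { (w ∷ v ∷ []) (h ∷ []) → (w :⨯ v) :· (λ i → v i :+ h :* w i) , con (+ 0) }) refl

  -- Assembling the equivalences

  projected⇒vanishing : ∀ r x → (∀ a → x a ∈ r) → IsProjectedQuadrilateralSet r x →
    ∀ ℓ P¹ P² P³ → QS x ℓ P¹ P² P³ ≈ 0#
  projected⇒vanishing r x x∈r p ℓ =
    let P , P∉r , QS≈0 = projected⇒QS r x p in QS-vanishes r x x∈r ℓ P P∉r (QS≈0 ℓ)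

  -- A frame point off `r` serves as centre of projection, so the diagonal values at the frame
  -- points are what enters.
  vanishing⇒projected : ∀ r x → (∀ a → x a ∈ r) → (∀ a b → a ≢ b → x a ≠ x b) →
    ∀ R U → IsFrame R U → (∀ j → QS x ℓ₁₂₃ (R j) (R j) (R j) ≈ 0#) → IsProjectedQuadrilateralSet r x
  vanishing⇒projected r x x∈r x-distinct R U frame QS≈0 =
    let j , Rⱼ∉r = frame-off {R} {U} frame r
    in Lift.projected r x x∈r x-distinct (R j) Rⱼ∉r (QS≈0 j)

open import Defs

theorem4p7 : (r : Line) (x : Label → Point) →
    (∀ a → x a ∈ r) →
    (∀ a b → a ≢ b → x a ≠ x b) →
    (R : Fin 3 → Point) (U : Point) → IsFrame R U →
    AllEquivalent
    ( IsProjectedQuadrilateralSet r x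
    ∷ (∀ ℓ P¹ P² P³ → QS x ℓ P¹ P² P³ ≈ℂ 0ℂ)
    ∷ (∀ ℓ i j k → QS x ℓ (R i) (R j) (R k) ≈ℂ 0ℂ)
    ∷ (∀ i j k → QS x ℓ₁₂₃ (R i) (R j) (R k) ≈ℂ 0ℂ)
    ∷ (∀ i j k → i ≤ j → j ≤ k → QS x ℓ₁₂₃ (R i) (R j) (R k) ≈ℂ 0ℂ)
    ∷ [] )
-- Statement (v) is the hub: `to` reaches it from every statement, and `from` returns to the others
-- through (i).
theorem4p7 r x x∈r x-distinct R U frame i j = mk⇔ (from j ∘ to i) (from i ∘ to j)
  where
  ⟨v⟩ : Set
  ⟨v⟩ = ∀ i j k → i ≤ j → j ≤ k → QS x ℓ₁₂₃ (R i) (R j) (R k) ≈ℂ 0ℂ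

  statements : Vec Set 5
  statements =
    ( IsProjectedQuadrilateralSet r x
    ∷ (∀ ℓ P¹ P² P³ → QS x ℓ P¹ P² P³ ≈ℂ 0ℂ)
    ∷ (∀ ℓ i j k → QS x ℓ (R i) (R j) (R k) ≈ℂ 0ℂ)
    ∷ (∀ i j k → QS x ℓ₁₂₃ (R i) (R j) (R k) ≈ℂ 0ℂ)
    ∷ ⟨v⟩
    ∷ [] )

  ⟨i⟩⇒⟨ii⟩ : IsProjectedQuadrilateralSet r x → ∀ ℓ P¹ P² P³ → QS x ℓ P¹ P² P³ ≈ℂ 0ℂ
  ⟨i⟩⇒⟨ii⟩ = Plane.projected⇒vanishing ℂ-heytingField r x x∈r

  ⟨v⟩⇒⟨i⟩ : ⟨v⟩ → IsProjectedQuadrilateralSet r x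
  ⟨v⟩⇒⟨i⟩ QS≈0 = Plane.vanishing⇒projected ℂ-heytingField r x x∈r x-distinct R U frame
    λ j → QS≈0 j j j ≤-refl ≤-refl

  to : ∀ i → Vec.lookup statements i → ⟨v⟩
  to zero p i j k _ _ = ⟨i⟩⇒⟨ii⟩ p ℓ₁₂₃ (R i) (R j) (R k)
  to (suc zero) h i j k _ _ = h ℓ₁₂₃ (R i) (R j) (R k)
  to (suc (suc zero)) h i j k _ _ = h ℓ₁₂₃ i j k
  to (suc (suc (suc zero))) h i j k _ _ = h i j k
  to (suc (suc (suc (suc zero)))) h = h

  from : ∀ i → ⟨v⟩ → Vec.lookup statements i
  from zero h = ⟨v⟩⇒⟨i⟩ h
  from (suc zero) h = ⟨i⟩⇒⟨ii⟩ (⟨v⟩⇒⟨i⟩ h)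
  from (suc (suc zero)) h ℓ i j k = ⟨i⟩⇒⟨ii⟩ (⟨v⟩⇒⟨i⟩ h) ℓ (R i) (R j) (R k)
  from (suc (suc (suc zero))) h i j k = ⟨i⟩⇒⟨ii⟩ (⟨v⟩⇒⟨i⟩ h) ℓ₁₂₃ (R i) (R j) (R k)
  from (suc (suc (suc (suc zero)))) h = h
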